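{- Let $G$ be an $(s,k)$-edge-connected graph such that $k\geq 2$ and $\deg(s)>4$. Suppose that $L(G,s,k)$ and its complement are both connected (so $I(L(G,s,k))$ is a path or a cycle), let $I_1,\dots,I_m$ be the maximal independent sets of $L(G,s,k)$ in order along this path or cycle, and let $A_i$ be the dangerous set corresponding to $I_i$. Then: (i) If $I(L(G,s,k))$ is a cycle, then $G$ has an $(s,(k-1)/2)$-cycle structure whose blobs are the subgraphs induced by $A_m\cap A_1$ and by $A_i\cap A_{i+1}$ for $i=1,\dots,m-1$. (ii) If $I(L(G,s,k))$ is a path, then $G$ has an $(s,(k-1)/2)$-path structure whose blobs are the subgraphs induced by $A_1\setminus A_2$, by $A_i\cap A_{i+1}$ for $i=1,\dots,m-1$, and by $A_m\setminus A_{m-1}$ (in this order along the path).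
   Context: All graphs are finite loopless multigraphs. $\delta(X)$ is the set of edges with exactly one end in $X$. A graph $G$ is $(s,k)$-edge-connected if $G$ has at least three vertices, $s\in V(G)$, $k$ is a positive integer, and any two vertices of $G$ different from $s$ are joined by $k$ pairwise edge-disjoint paths in $G$ (which may pass through $s$). Lifting edges $sv,sw$ means deleting them and adding $vw$ if $v\ne w$, only deleting them if $v=w$; result $G_{v,w}$. $sv,sw$ are $k$-liftable if $G_{v,w}$ is $(s,k)$-edge-connected. $L(G,s,k)$ has vertex set the edges at $s$, adjacent iff $k$-liftable. A set $A\subseteq V(G)\setminus\{s\}$ is dangerous if $A\ne\emptyset$, $V(G)\setminus(A\cup\{s\})\neq\emptyset$ and $|\delta(A)|\le k+1$. For an independent set $F$ of $L(G,s,k)$ with $|F|\ge 2$ and $F\ne V(L(G,s,k))$, the dangerous set corresponding to $F$ is the unique inclusion-minimal dangerous set containing the end other than $s$ of every edge of $F$. The independence graph $I(H)$ of a graph $H$ has as vertices the maximal independent sets of $H$, two adjacent iff they intersect. Path/cycle structure: for $r\ge1$, $n\ge 3$, pairwise disjoint subgraphs $H_0,\dots,H_{n-1}$ (blobs) of $G-s$ covering $V(G-s)$; $G$ has an $(s,r)$-cycle structure if for every $i$, $\delta(H_i)$ consists of exactly $2r+1$ edges: one to $s$, $r$ to $H_{i-1}$, $r$ to $H_{i+1}$ (indices mod $n$); an $(s,r)$-path structure if this holds for $i=1,\dots,n-2$. -}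

module Defs where

open import Data.Nat using (ℕ; zero; suc; _+_; _*_; _∸_; _≤_; _<_; _≡ᵇ_)
open import Data.Bool using (Bool; true; false; if_then_else_; _∧_; _∨_; _xor_; not)
open import Data.Fin using (Fin) renaming (zero to fzero; suc to fsuc)
import Data.Fin as Fin
open import Data.Fin.Subset using (Subset; _∈_; _∉_; _⊆_; _∩_; _─_; Nonempty; ⁅_⁆)
open import Data.List using (List; []; _∷_; length; lookup; _++_)
open import Data.List.Relation.Unary.All using (All)
open import Data.List.Relation.Unary.Unique.Propositional using (Unique)
open import Data.List.Relation.Binary.Disjoint.Propositional using (Disjoint)
open import Data.Vec using () renaming (lookup to vlookup)
open import Data.Product using (Σ; ∃; _×_; _,_; proj₁; proj₂)
open import Data.Sum using (_⊎_)
open import Relation.Nullary using (¬_; Dec; yes; no)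
open import Relation.Nullary.Decidable using (⌊_⌋)
open import Relation.Binary.PropositionalEquality using (_≡_; _≢_)
open import Relation.Binary.Construct.Closure.ReflexiveTransitive using (Star)

-- Graphs.  A finite loopless multigraph on vertex set Fin n is a list of
-- edges (pairs of distinct vertices); an edge is identified by its position
-- in the list, so parallel edges are distinct edges.

Graph : ℕ → Set
Graph n = List (Fin n × Fin n)

Edge : ∀ {n} → Graph n → Set
Edge G = Fin (length G)

ends : ∀ {n} (G : Graph n) → Edge G → Fin n × Fin n
ends G e = lookup G e

Loopless : ∀ {n} → Graph n → Set
Loopless G = All (λ p → proj₁ p ≢ proj₂ p) G

count : ∀ {A : Set} → (A → Bool) → List A → ℕ
count p [] = 0
count p (x ∷ xs) = if p x then suc (count p xs) else count p xs

memᵇ : ∀ {n} → Fin n → Subset n → Bool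
memᵇ v X = vlookup X v

δsize : ∀ {n} → Graph n → Subset n → ℕ
δsize G X = count (λ p → memᵇ (proj₁ p) X xor memᵇ (proj₂ p) X) G

between : ∀ {n} → Graph n → Subset n → Subset n → ℕ
between G X Y = count (λ p → (memᵇ (proj₁ p) X ∧ memᵇ (proj₂ p) Y)
                            ∨ (memᵇ (proj₂ p) X ∧ memᵇ (proj₁ p) Y)) G

-- degree of a vertex (G is loopless)
deg : ∀ {n} → Graph n → Fin n → ℕ
deg G s = count (λ p → ⌊ proj₁ p Fin.≟ s ⌋ ∨ ⌊ proj₂ p Fin.≟ s ⌋) G

Joins : ∀ {n} (G : Graph n) → Edge G → Fin n → Fin n → Set
Joins G e u x = (ends G e ≡ (u , x)) ⊎ (ends G e ≡ (x , u))

data Walk {n} (G : Graph n) : Fin n → Fin n → Set where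
  nil  : ∀ {u} → Walk G u u
  cons : ∀ {u x v} (e : Edge G) → Joins G e u x → Walk G x v → Walk G u v

walkVerts : ∀ {n} {G : Graph n} {u v} → Walk G u v → List (Fin n)
walkVerts {u = u} nil = u ∷ []
walkVerts {u = u} (cons e j w) = u ∷ walkVerts w

walkEdges : ∀ {n} {G : Graph n} {u v} → Walk G u v → List (Edge G)
walkEdges nil = []
walkEdges (cons e j w) = e ∷ walkEdges w

IsPath : ∀ {n} {G : Graph n} {u v} → Walk G u v → Set
IsPath w = Unique (walkVerts w)

EdgeDisjointPaths : ∀ {n} → Graph n → ℕ → Fin n → Fin n → Set
EdgeDisjointPaths G k u v =
  Σ (Fin k → Walk G u v) λ P →
    (∀ i → IsPath (P i)) ×
    (∀ i j → i ≢ j → Disjoint (walkEdges (P i)) (walkEdges (P j)))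

SKEdgeConnected : ∀ {n} → Graph n → Fin n → ℕ → Set
SKEdgeConnected {n} G s k =
  3 ≤ n × 1 ≤ k ×
  (∀ u v → u ≢ s → v ≢ s → u ≢ v → EdgeDisjointPaths G k u v)

AtS : ∀ {n} (G : Graph n) → Fin n → Edge G → Set
AtS G s e = (proj₁ (ends G e) ≡ s) ⊎ (proj₂ (ends G e) ≡ s)

-- the end of an edge other than s (for edges at s)
otherEnd : ∀ {n} → Fin n → Fin n × Fin n → Fin n
otherEnd s (a , b) = if ⌊ a Fin.≟ s ⌋ then b else a

dropIdx : ∀ {A : Set} (xs : List A) → (Fin (length xs) → Bool) → List A
dropIdx [] p = []
dropIdx (x ∷ xs) p =
  if p fzero then dropIdx xs (λ i → p (fsuc i)) else x ∷ dropIdx xs (λ i → p (fsuc i))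

lift : ∀ {n} (G : Graph n) → Fin n → Edge G → Edge G → Graph n
lift G s e₁ e₂ =
  dropIdx G (λ i → ⌊ i Fin.≟ e₁ ⌋ ∨ ⌊ i Fin.≟ e₂ ⌋)
  ++ (if ⌊ v Fin.≟ w ⌋ then [] else (v , w) ∷ [])
  where
    v = otherEnd s (ends G e₁)
    w = otherEnd s (ends G e₂)

-- adjacency in L(G,s,k): distinct edges at s that are k-liftable
Liftable : ∀ {n} (G : Graph n) → Fin n → ℕ → Edge G → Edge G → Set
Liftable G s k e₁ e₂ =
  AtS G s e₁ × AtS G s e₂ × e₁ ≢ e₂ × SKEdgeConnected (lift G s e₁ e₂) s k

NonLiftable : ∀ {n} (G : Graph n) → Fin n → ℕ → Edge G → Edge G → Set
NonLiftable G s k e₁ e₂ =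
  AtS G s e₁ × AtS G s e₂ × e₁ ≢ e₂ × ¬ SKEdgeConnected (lift G s e₁ e₂) s k

ConnectedOnAtS : ∀ {n} (G : Graph n) → Fin n → (Edge G → Edge G → Set) → Set
ConnectedOnAtS G s R = ∀ e f → AtS G s e → AtS G s f → Star R e f

-- sets of vertices of L(G,s,k) are subsets of the edge set of G contained in AtS
Independent : ∀ {n} (G : Graph n) → Fin n → ℕ → Subset (length G) → Set
Independent G s k F =
  (∀ e → e ∈ F → AtS G s e) × (∀ e f → e ∈ F → f ∈ F → ¬ Liftable G s k e f)

MaximalIndependent : ∀ {n} (G : Graph n) → Fin n → ℕ → Subset (length G) → Set
MaximalIndependent G s k F =
  Independent G s k F × (∀ F′ → Independent G s k F′ → F ⊆ F′ → F′ ⊆ F)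

Dangerous : ∀ {n} (G : Graph n) → Fin n → ℕ → Subset n → Set
Dangerous G s k A =
  Nonempty A × s ∉ A × (∃ λ v → v ≢ s × v ∉ A) × δsize G A ≤ k + 1

ContainsEnds : ∀ {n} (G : Graph n) → Fin n → Subset (length G) → Subset n → Set
ContainsEnds G s F A = ∀ e → e ∈ F → otherEnd s (ends G e) ∈ A

-- A is an inclusion-minimal dangerous set containing the ends of F
-- (by the paper this set is unique: the dangerous set corresponding to F)
CorrespondingDangerous : ∀ {n} (G : Graph n) → Fin n → ℕ →
                         Subset (length G) → Subset n → Set
CorrespondingDangerous G s k F A =
  Dangerous G s k A × ContainsEnds G s F A ×
  (∀ B → Dangerous G s k B → ContainsEnds G s F B → B ⊆ A → A ⊆ B)

Meet : ∀ {m} → Subset m → Subset m → Set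
Meet F F′ = Nonempty (F ∩ F′)

nextC : ℕ → ℕ → ℕ
nextC N i = if suc i ≡ᵇ N then 0 else suc i

prevC : ℕ → ℕ → ℕ
prevC N zero = N ∸ 1
prevC N (suc i) = i

EnumeratesMIS : ∀ {n} (G : Graph n) → Fin n → ℕ → (m : ℕ) →
                (ℕ → Subset (length G)) → Set
EnumeratesMIS G s k m I =
  (∀ i → i < m → MaximalIndependent G s k (I i)) ×
  (∀ F → MaximalIndependent G s k F → ∃ λ i → i < m × I i ≡ F) ×
  (∀ i j → i < m → j < m → i ≢ j → I i ≢ I j)

PathOrder : ∀ {e} → ℕ → (ℕ → Subset e) → Set
PathOrder m I = ∀ i j → i < m → j < m → i ≢ j →
  (Meet (I i) (I j) → (j ≡ suc i ⊎ i ≡ suc j)) ×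
  ((j ≡ suc i ⊎ i ≡ suc j) → Meet (I i) (I j))

CycleOrder : ∀ {e} → ℕ → (ℕ → Subset e) → Set
CycleOrder m I = 3 ≤ m × (∀ i j → i < m → j < m → i ≢ j →
  (Meet (I i) (I j) → (j ≡ nextC m i ⊎ i ≡ nextC m j)) ×
  ((j ≡ nextC m i ⊎ i ≡ nextC m j) → Meet (I i) (I j)))

-- Path / cycle structures; blobs are induced subgraphs given by vertex sets
-- H 0, …, H (N-1)

BlobsPartition : ∀ {n} → Fin n → ℕ → (ℕ → Subset n) → Set
BlobsPartition s N H =
  3 ≤ N ×
  (∀ i → i < N → Nonempty (H i) × s ∉ H i) ×
  (∀ i j → i < N → j < N → i ≢ j → ∀ v → v ∈ H i → v ∉ H j) ×
  (∀ v → v ≢ s → ∃ λ i → i < N × v ∈ H i)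

BlobCondition : ∀ {n} → Graph n → Fin n → ℕ → Subset n → Subset n → Subset n → Set
BlobCondition G s r X P Q =
  δsize G X ≡ suc (2 * r) × between G X ⁅ s ⁆ ≡ 1 ×
  between G X P ≡ r × between G X Q ≡ r

CycleStructure : ∀ {n} → Graph n → Fin n → ℕ → ℕ → (ℕ → Subset n) → Set
CycleStructure G s r N H =
  1 ≤ r × BlobsPartition s N H ×
  (∀ i → i < N → BlobCondition G s r (H i) (H (prevC N i)) (H (nextC N i)))

PathStructure : ∀ {n} → Graph n → Fin n → ℕ → ℕ → (ℕ → Subset n) → Set
PathStructure G s r N H =
  1 ≤ r × BlobsPartition s N H ×
  (∀ i → 1 ≤ i → suc i < N → BlobCondition G s r (H i) (H (i ∸ 1)) (H (suc i)))

cycleBlobs : ∀ {n} → ℕ → (ℕ → Subset n) → ℕ → Subset n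
cycleBlobs m A i = A i ∩ A (nextC m i)

-- the blobs of part (ii), m+1 of them:
-- A 0 ─ A 1, A 0 ∩ A 1, …, A (m-2) ∩ A (m-1), A (m-1) ─ A (m-2)
pathBlobs : ∀ {n} → ℕ → (ℕ → Subset n) → ℕ → Subset n
pathBlobs m A zero = A 0 ─ A 1
pathBlobs m A (suc j) = if suc j ≡ᵇ m then A j ─ A (j ∸ 1) else A j ∩ A (suc j)

module Submission where

-- Write d(X) = |δ(X)|; d(X) ≥ k whenever X and its complement both contain a vertex
-- other than s.  Lifting two edges of s that end in a dangerous set leaves too small a
-- cut, so I i consists of all edges of s ending in A i, and A i ∪ A j is never dangerous
-- for i ≠ j.
--
-- If I i and I j meet, an edge in both has a liftable partner, whose end lies outside
-- A i ∪ A j.  Hence all of A i ─ A j, A j ─ A i and A i ∩ A j have d ≥ k and A i ∪ A j has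
-- d ≥ k + 2, while d(A i) + d(A j) ≤ 2k + 2.  Sub- and posimodularity are then tight:
-- A i ∩ A j has d = k, one edge to s, and (k-1)/2 edges to each of the two differences.
-- If I i and I j are disjoint, posimodularity and minimality make A i and A j disjoint.
-- So a set A i with neighbours A p and A q is the disjoint union of A p ∩ A i and
-- A i ∩ A q, since what is left over would have d < k; this identifies the blobs.  In the
-- same way the vertices in no A i would form a set with d < k, so there are none.
-- Cycles of length 3 cannot occur.

open import Defs
import Data.Nat as ℕ
open import Data.Nat using (ℕ; zero; suc; _+_; _*_; _≤_; _<_; pred; z≤n; s≤s; s≤s⁻¹; _≤?_; _≡ᵇ_)
open import Data.Nat.Properties hiding (suc-injective; _≟_)
open import Data.Nat.ListAction using (sum)
open import Algebra.Properties.CommutativeSemigroup +-commutativeSemigroup using (interchange)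
open import Data.Bool using (Bool; true; false; _∧_; _∨_; _xor_; not; if_then_else_)
import Data.Bool.Properties as Bool
open import Data.Fin using (Fin; zero; suc; _≟_)
open import Data.Fin.Properties using (injective⇒≤; any?; suc-injective)
open import Data.Fin.Subset using (Subset; _∈_; _∉_; _⊆_; _∩_; _∪_; _─_; _⊃_; ∁; ⁅_⁆; Nonempty)
open import Data.Fin.Subset.Properties
open import Data.Fin.Subset.Induction using (Acc; acc; ⊃-wellFounded)
open import Data.List using (List; []; _∷_; length; lookup; _++_; map)
import Data.List.Membership.Propositional as List
open import Data.List.Membership.Propositional.Properties using (∈-lookup)
open import Data.List.Relation.Unary.Any using (here; there)
import Data.List.Relation.Unary.All as All
open import Data.Vec using ([]; _∷_; tabulate)
open import Data.Vec.Properties using ([]=⇒lookup; lookup⇒[]=; lookup-zipWith; lookup-map; lookup∘tabulate)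
open import Data.Product using (∃; _×_; _,_; proj₁; proj₂)
open import Data.Sum using (_⊎_; inj₁; inj₂; [_,_]′)
open import Data.Unit using (tt)
open import Data.Empty using (⊥; ⊥-elim)
open import Function using (_∘_)
open import Relation.Nullary using (¬_; Dec; yes; no; contradiction)
open import Relation.Nullary.Decidable using (⌊_⌋; map′; _×-dec_; _⊎-dec_; _→-dec_; ¬?; toWitness; does; dec-true)
open import Relation.Binary.Construct.Closure.ReflexiveTransitive using (Star; ε; _◅_)
open import Relation.Binary.Definitions using (tri<; tri≈; tri>)
open import Relation.Binary.PropositionalEquality using (_≡_; _≢_; refl; sym; trans; cong; cong₂; subst; subst₂)

-- Counting edges

-- Makes statements about finitely many bits decidable, so that `toWitness` settles each pointwise
-- inequality between cuts by running through its truth table.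
∀Bool? : {P : Bool → Set} → (∀ b → Dec (P b)) → Dec (∀ b → P b)
∀Bool? P? = map′ (λ { (t , f) true → t ; (t , f) false → f }) (λ h → h true , h false)
  (P? true ×-dec P? false)

indicator : Bool → ℕ
indicator b = if b then 1 else 0

weight : {A : Set} → List (A → Bool) → A → ℕ
weight ps x = sum (map (λ p → indicator (p x)) ps)

totalCount : {A : Set} → List (A → Bool) → List A → ℕ
totalCount ps xs = sum (map (λ p → count p xs) ps)

count-∷ : {A : Set} (p : A → Bool) (x : A) (xs : List A) →
  count p (x ∷ xs) ≡ indicator (p x) + count p xs
count-∷ p x xs with p x
... | true  = refl
... | false = refl

totalCount-[] : {A : Set} (ps : List (A → Bool)) → totalCount ps [] ≡ 0
totalCount-[] []       = refl
totalCount-[] (p ∷ ps) = totalCount-[] ps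

totalCount-∷ : {A : Set} (ps : List (A → Bool)) (x : A) (xs : List A) →
  totalCount ps (x ∷ xs) ≡ weight ps x + totalCount ps xs
totalCount-∷ []       x xs = refl
totalCount-∷ (p ∷ ps) x xs =
  trans (cong₂ _+_ (count-∷ p x xs) (totalCount-∷ ps x xs))
        (interchange (indicator (p x)) (count p xs) (weight ps x) (totalCount ps xs))

-- Linear inequalities between cut sizes are thereby reduced to a check on the membership
-- bits of the two ends of a single edge.
totalCount-mono : {A : Set} (ps qs : List (A → Bool)) (xs : List A) →
  (∀ i → weight ps (lookup xs i) ≤ weight qs (lookup xs i)) →
  totalCount ps xs ≤ totalCount qs xs
totalCount-mono ps qs []       h = subst (_≤ totalCount qs []) (sym (totalCount-[] ps)) z≤n
totalCount-mono ps qs (x ∷ xs) h =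
  subst₂ _≤_ (sym (totalCount-∷ ps x xs)) (sym (totalCount-∷ qs x xs))
    (+-mono-≤ (h zero) (totalCount-mono ps qs xs (h ∘ suc)))

-- Numbers the hits of `p` in order of position. Since the numbering is injective, any family of
-- distinct hits bounds `count` from below by pigeonhole.
rank : {A : Set} (p : A → Bool) (xs : List A) (i : Fin (length xs)) →
  p (lookup xs i) ≡ true → Fin (count p xs)
rank p (x ∷ xs) zero    h with p x
rank p (x ∷ xs) zero    refl | true = zero
rank p (x ∷ xs) (suc i) h with p x
... | true  = suc (rank p xs i h)
... | false = rank p xs i h

rank-injective : {A : Set} (p : A → Bool) (xs : List A) (i j : Fin (length xs))
  (hi : p (lookup xs i) ≡ true) (hj : p (lookup xs j) ≡ true) →
  rank p xs i hi ≡ rank p xs j hj → i ≡ j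
rank-injective p (x ∷ xs) zero    zero    hi   hj   eq = refl
rank-injective p (x ∷ xs) zero    (suc j) hi   hj   eq with p x
rank-injective p (x ∷ xs) zero    (suc j) refl hj   () | true
rank-injective p (x ∷ xs) (suc i) zero    hi   hj   eq with p x
rank-injective p (x ∷ xs) (suc i) zero    hi   refl () | true
rank-injective p (x ∷ xs) (suc i) (suc j) hi   hj   eq with p x
... | true  = cong suc (rank-injective p xs i j hi hj (suc-injective eq))
... | false = cong suc (rank-injective p xs i j hi hj eq)

injection⇒≤count : {A : Set} (p : A → Bool) (xs : List A) {k : ℕ} (f : Fin k → Fin (length xs)) →
  (∀ i → p (lookup xs (f i)) ≡ true) → (∀ i j → f i ≡ f j → i ≡ j) → k ≤ count p xs
injection⇒≤count p xs f hit inj =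
  injective⇒≤ {f = λ i → rank p xs (f i) (hit i)}
    λ {i} {j} eq → inj i j (rank-injective p xs (f i) (f j) (hit i) (hit j) eq)

count-positive : {A : Set} (p : A → Bool) (xs : List A) (i : Fin (length xs)) →
  p (lookup xs i) ≡ true → 1 ≤ count p xs
count-positive p xs i h = injection⇒≤count p xs {1} (λ _ → i) (λ _ → h) λ { zero zero _ → refl }

count⇒hit : {A : Set} (p : A → Bool) (xs : List A) → 1 ≤ count p xs →
  ∃ λ i → p (lookup xs i) ≡ true
count⇒hit p (x ∷ xs) h with p x in eq
... | true  = zero , eq
... | false with count⇒hit p xs h
...   | i , hi = suc i , hi

count⇒otherHit : {A : Set} (p : A → Bool) (xs : List A) → 2 ≤ count p xs →
  ∀ i → ∃ λ j → j ≢ i × p (lookup xs j) ≡ true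
count⇒otherHit p (x ∷ xs) h i with p x in eq
count⇒otherHit p (x ∷ xs) (s≤s h) zero    | true with count⇒hit p xs h
... | j , hj = suc j , (λ ()) , hj
count⇒otherHit p (x ∷ xs) h (suc i) | true = zero , (λ ()) , eq
count⇒otherHit p (x ∷ xs) h zero    | false with count⇒hit p xs (≤-trans (s≤s z≤n) h)
... | j , hj = suc j , (λ ()) , hj
count⇒otherHit p (x ∷ xs) h (suc i) | false with count⇒otherHit p xs h i
... | j , j≢i , hj = suc j , (λ e → j≢i (suc-injective e)) , hj

-- Subsets

∈⇒mem : ∀ {n} {v : Fin n} {X} → v ∈ X → memᵇ v X ≡ true
∈⇒mem = []=⇒lookup

mem⇒∈ : ∀ {n} {v : Fin n} {X} → memᵇ v X ≡ true → v ∈ X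
mem⇒∈ {v = v} {X} = lookup⇒[]= v X

∉⇒mem : ∀ {n} {v : Fin n} {X} → v ∉ X → memᵇ v X ≡ false
∉⇒mem v∉X = Bool.¬-not (v∉X ∘ mem⇒∈)

mem⇒∉ : ∀ {n} {v : Fin n} {X} → memᵇ v X ≡ false → v ∉ X
mem⇒∉ h v∈X = contradiction (trans (sym (∈⇒mem v∈X)) h) λ ()

mem-∩ : ∀ {n} (X Y : Subset n) v → memᵇ v (X ∩ Y) ≡ memᵇ v X ∧ memᵇ v Y
mem-∩ X Y v = lookup-zipWith _∧_ v X Y

mem-∪ : ∀ {n} (X Y : Subset n) v → memᵇ v (X ∪ Y) ≡ memᵇ v X ∨ memᵇ v Y
mem-∪ X Y v = lookup-zipWith _∨_ v X Y

mem-∁ : ∀ {n} (X : Subset n) v → memᵇ v (∁ X) ≡ not (memᵇ v X)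
mem-∁ X v = lookup-map v not X

mem-─ : ∀ {n} (X Y : Subset n) v → memᵇ v (X ─ Y) ≡ memᵇ v X ∧ not (memᵇ v Y)
mem-─ (x ∷ X) (true  ∷ Y) zero    = sym (Bool.∧-zeroʳ x)
mem-─ (x ∷ X) (false ∷ Y) zero    = sym (Bool.∧-identityʳ x)
mem-─ (x ∷ X) (y ∷ Y)     (suc v) = mem-─ X Y v

x∈p─q⇒x∉q : ∀ {n} (X Y : Subset n) {v} → v ∈ X ─ Y → v ∉ Y
x∈p─q⇒x∉q X Y {v} v∈ v∈Y with trans (sym (mem-─ X Y v)) (∈⇒mem v∈)
... | h rewrite ∈⇒mem v∈Y | Bool.∧-zeroʳ (memᵇ v X) = contradiction h λ ()

-- The cut function

crosses : ∀ {n} → Subset n → Fin n × Fin n → Bool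
crosses X p = memᵇ (proj₁ p) X xor memᵇ (proj₂ p) X

links : ∀ {n} → Subset n → Subset n → Fin n × Fin n → Bool
links X Y p = (memᵇ (proj₁ p) X ∧ memᵇ (proj₂ p) Y) ∨ (memᵇ (proj₂ p) X ∧ memᵇ (proj₁ p) Y)

module _ {n} (G : Graph n) (A B : Subset n) where

  submodular : δsize G (A ∩ B) + δsize G (A ∪ B) ≤ δsize G A + δsize G B
  submodular = subst₂ (λ x y → δsize G (A ∩ B) + x ≤ δsize G A + y) (+-identityʳ _) (+-identityʳ _)
    (totalCount-mono (crosses (A ∩ B) ∷ crosses (A ∪ B) ∷ []) (crosses A ∷ crosses B ∷ []) G
      λ i → pointwise (lookup G i))
    where
    pointwise : ∀ p → weight (crosses (A ∩ B) ∷ crosses (A ∪ B) ∷ []) p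
                    ≤ weight (crosses A ∷ crosses B ∷ []) p
    pointwise (u , v) rewrite mem-∩ A B u | mem-∩ A B v | mem-∪ A B u | mem-∪ A B v =
      toWitness {a? = ∀Bool? λ a → ∀Bool? λ b → ∀Bool? λ a′ → ∀Bool? λ b′ →
        indicator ((a ∧ b) xor (a′ ∧ b′)) + (indicator ((a ∨ b) xor (a′ ∨ b′)) + 0)
          ≤? indicator (a xor a′) + (indicator (b xor b′) + 0)} tt
        (memᵇ u A) (memᵇ u B) (memᵇ v A) (memᵇ v B)

  -- An edge from `A ∩ B` to the complement of `A ∪ B` lies in the cuts of `A` and of `B` but in
  -- neither cut on the left; hence the extra term with factor 2, which later limits the edges to
  -- `s`.
  posimodular : δsize G (A ─ B) + δsize G (B ─ A) + 2 * between G (A ∩ B) (∁ (A ∪ B))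
              ≤ δsize G A + δsize G B
  -- The factor 2 is encoded by listing `out` twice: `2 * x` unfolds to `x + (x + 0)`, the shape
  -- that `sum` produces.
  posimodular = subst₂ _≤_ (sym (+-assoc (δsize G (A ─ B)) _ _)) (cong (δsize G A +_) (+-identityʳ _))
    (totalCount-mono (crosses (A ─ B) ∷ crosses (B ─ A) ∷ out ∷ out ∷ []) (crosses A ∷ crosses B ∷ []) G
      λ i → pointwise (lookup G i))
    where
    out : Fin n × Fin n → Bool
    out = links (A ∩ B) (∁ (A ∪ B))

    pointwise : ∀ p → weight (crosses (A ─ B) ∷ crosses (B ─ A) ∷ out ∷ out ∷ []) p
                    ≤ weight (crosses A ∷ crosses B ∷ []) p
    pointwise (u , v) rewrite mem-∩ A B u | mem-∩ A B v | mem-─ A B u | mem-─ A B v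
      | mem-─ B A u | mem-─ B A v | mem-∁ (A ∪ B) u | mem-∁ (A ∪ B) v | mem-∪ A B u | mem-∪ A B v =
      toWitness {a? = ∀Bool? λ a → ∀Bool? λ b → ∀Bool? λ a′ → ∀Bool? λ b′ →
        let o = indicator (((a ∧ b) ∧ not (a′ ∨ b′)) ∨ ((a′ ∧ b′) ∧ not (a ∨ b))) in
        indicator ((a ∧ not b) xor (a′ ∧ not b′))
          + (indicator ((b ∧ not a) xor (b′ ∧ not a′)) + (o + (o + 0)))
          ≤? indicator (a xor a′) + (indicator (b xor b′) + 0)} tt
        (memᵇ u A) (memᵇ u B) (memᵇ v A) (memᵇ v B)

  -- Only the edges between the two parts of `A` are in both cuts on the left without leaving `A`.
  -- Being an equality, this is what yields the parity of `k`.
  δsize-split : δsize G (A ─ B) + δsize G (A ∩ B) ≡ δsize G A + 2 * between G (A ∩ B) (A ─ B)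
  δsize-split = ≤-antisym
    (subst (_≤ δsize G A + 2 * between G (A ∩ B) (A ─ B)) (cong (δsize G (A ─ B) +_) (+-identityʳ _))
      (totalCount-mono parts whole G λ i → ≤-reflexive (pointwise (lookup G i))))
    (subst (δsize G A + 2 * between G (A ∩ B) (A ─ B) ≤_) (cong (δsize G (A ─ B) +_) (+-identityʳ _))
      (totalCount-mono whole parts G λ i → ≤-reflexive (sym (pointwise (lookup G i)))))
    where
    parts whole : List (Fin n × Fin n → Bool)
    parts = crosses (A ─ B) ∷ crosses (A ∩ B) ∷ []
    whole = crosses A ∷ links (A ∩ B) (A ─ B) ∷ links (A ∩ B) (A ─ B) ∷ []

    pointwise : ∀ p → weight parts p ≡ weight whole p
    pointwise (u , v) rewrite mem-∩ A B u | mem-∩ A B v | mem-─ A B u | mem-─ A B v =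
      toWitness {a? = ∀Bool? λ a → ∀Bool? λ b → ∀Bool? λ a′ → ∀Bool? λ b′ →
        let o = indicator (((a ∧ b) ∧ (a′ ∧ not b′)) ∨ ((a′ ∧ b′) ∧ (a ∧ not b))) in
        indicator ((a ∧ not b) xor (a′ ∧ not b′)) + (indicator ((a ∧ b) xor (a′ ∧ b′)) + 0)
          Data.Nat.≟ indicator (a xor a′) + (o + (o + 0))} tt
        (memᵇ u A) (memᵇ u B) (memᵇ v A) (memᵇ v B)

  -- Applied with `T = ⁅ s ⁆`, to separate the edges to `s` from all other edges leaving the union.
  between-split : (T : Subset n) →
    between G (A ∩ B) (∁ (A ∪ B) ∩ T) + between G (A ∩ B) (∁ (A ∪ B) ─ T)
      ≤ between G (A ∩ B) (∁ (A ∪ B))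
  between-split T = subst₂ _≤_ (cong (between G (A ∩ B) (∁ (A ∪ B) ∩ T) +_) (+-identityʳ _)) (+-identityʳ _)
    (totalCount-mono parts whole G λ i → pointwise (lookup G i))
    where
    parts whole : List (Fin n × Fin n → Bool)
    parts = links (A ∩ B) (∁ (A ∪ B) ∩ T) ∷ links (A ∩ B) (∁ (A ∪ B) ─ T) ∷ []
    whole = links (A ∩ B) (∁ (A ∪ B)) ∷ []

    pointwise : ∀ p → weight parts p ≤ weight whole p
    pointwise (u , v) rewrite mem-∩ A B u | mem-∩ A B v
      | mem-∩ (∁ (A ∪ B)) T u | mem-∩ (∁ (A ∪ B)) T v | mem-─ (∁ (A ∪ B)) T u | mem-─ (∁ (A ∪ B)) T v
      | mem-∁ (A ∪ B) u | mem-∁ (A ∪ B) v | mem-∪ A B u | mem-∪ A B v =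
      toWitness {a? = ∀Bool? λ a → ∀Bool? λ b → ∀Bool? λ t → ∀Bool? λ a′ → ∀Bool? λ b′ → ∀Bool? λ t′ →
        indicator (((a ∧ b) ∧ (not (a′ ∨ b′) ∧ t′)) ∨ ((a′ ∧ b′) ∧ (not (a ∨ b) ∧ t)))
          + (indicator (((a ∧ b) ∧ (not (a′ ∨ b′) ∧ not t′)) ∨ ((a′ ∧ b′) ∧ (not (a ∨ b) ∧ not t))) + 0)
          ≤? indicator (((a ∧ b) ∧ not (a′ ∨ b′)) ∨ ((a′ ∧ b′) ∧ not (a ∨ b))) + 0} tt
        (memᵇ u A) (memᵇ u B) (memᵇ u T) (memᵇ v A) (memᵇ v B) (memᵇ v T)

-- Menger's easy direction, and lifting

crossingEdge : ∀ {n} {G : Graph n} (X : Subset n) {u v} (w : Walk G u v) → u ∈ X → v ∉ X →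
  ∃ λ e → e List.∈ walkEdges w × crosses X (ends G e) ≡ true
crossingEdge X nil u∈X v∉X = contradiction u∈X v∉X
crossingEdge {G = G} X (cons {u} {x} e j w) u∈X v∉X with x ∈? X
... | yes x∈X with crossingEdge X w x∈X v∉X
...   | f , f∈w , hf = f , there f∈w , hf
crossingEdge {G = G} X (cons {u} {x} e j w) u∈X v∉X | no x∉X = e , here refl , go j
  where
  go : Joins G e u x → crosses X (ends G e) ≡ true
  go (inj₁ eq) rewrite eq | ∈⇒mem u∈X | ∉⇒mem x∉X = refl
  go (inj₂ eq) rewrite eq | ∈⇒mem u∈X | ∉⇒mem x∉X = refl

-- Each walk leaves `X` along some edge, and edge-disjointness makes the chosen edges distinct.
paths⇒cut : ∀ {n} {G : Graph n} {k u v} (X : Subset n) → EdgeDisjointPaths G k u v →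
  u ∈ X → v ∉ X → k ≤ δsize G X
paths⇒cut {G = G} {k} X (P , _ , disj) u∈X v∉X =
  injection⇒≤count (crosses X) G (λ i → proj₁ (cross i)) (λ i → proj₂ (proj₂ (cross i))) inj
  where
  cross : ∀ i → ∃ λ e → e List.∈ walkEdges (P i) × crosses X (ends G e) ≡ true
  cross i = crossingEdge X (P i) u∈X v∉X

  inj : ∀ i j → proj₁ (cross i) ≡ proj₁ (cross j) → i ≡ j
  inj i j eq with i ≟ j
  ... | yes i≡j = i≡j
  ... | no  i≢j = ⊥-elim (disj i j i≢j (proj₁ (proj₂ (cross i)) ,
    subst (List._∈ walkEdges (P j)) (sym eq) (proj₁ (proj₂ (cross j)))))

connected⇒cut : ∀ {n} {G : Graph n} {s k} → SKEdgeConnected G s k → (X : Subset n) → s ∉ X →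
  Nonempty X → (∃ λ v → v ≢ s × v ∉ X) → k ≤ δsize G X
connected⇒cut (_ , _ , conn) X s∉X (u , u∈X) (v , v≢s , v∉X) =
  paths⇒cut X (conn u v (λ { refl → s∉X u∈X }) v≢s (λ { refl → v∉X u∈X })) u∈X v∉X

count-dropIdx : {A : Set} (p : A → Bool) (xs : List A) (d : Fin (length xs) → Bool) →
  count p (dropIdx xs d) ≤ count p xs
count-dropIdx p []       d = z≤n
count-dropIdx p (x ∷ xs) d with d zero
... | true  rewrite count-∷ p x xs = ≤-trans (count-dropIdx p xs (d ∘ suc)) (m≤n+m _ (indicator (p x)))
... | false rewrite count-∷ p x xs | count-∷ p x (dropIdx xs (d ∘ suc)) =
  +-monoʳ-≤ (indicator (p x)) (count-dropIdx p xs (d ∘ suc))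

count-dropIdx₁ : {A : Set} (p : A → Bool) (xs : List A) (d : Fin (length xs) → Bool) →
  ∀ i → d i ≡ true → p (lookup xs i) ≡ true → 1 + count p (dropIdx xs d) ≤ count p xs
count-dropIdx₁ p (x ∷ xs) d zero di pi rewrite di | pi = s≤s (count-dropIdx p xs (d ∘ suc))
count-dropIdx₁ p (x ∷ xs) d (suc i) di pi with d zero
... | true  rewrite count-∷ p x xs =
  ≤-trans (count-dropIdx₁ p xs (d ∘ suc) i di pi) (m≤n+m _ (indicator (p x)))
... | false rewrite count-∷ p x xs | count-∷ p x (dropIdx xs (d ∘ suc))
  | sym (+-suc (indicator (p x)) (count p (dropIdx xs (d ∘ suc)))) =
  +-monoʳ-≤ (indicator (p x)) (count-dropIdx₁ p xs (d ∘ suc) i di pi)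

count-dropIdx₂ : {A : Set} (p : A → Bool) (xs : List A) (d : Fin (length xs) → Bool) →
  ∀ i j → i ≢ j → d i ≡ true → d j ≡ true → p (lookup xs i) ≡ true → p (lookup xs j) ≡ true →
  2 + count p (dropIdx xs d) ≤ count p xs
count-dropIdx₂ p (x ∷ xs) d zero    zero    i≢j di dj pi pj = contradiction refl i≢j
count-dropIdx₂ p (x ∷ xs) d zero    (suc j) i≢j di dj pi pj rewrite di | pi =
  s≤s (count-dropIdx₁ p xs (d ∘ suc) j dj pj)
count-dropIdx₂ p (x ∷ xs) d (suc i) zero    i≢j di dj pi pj rewrite dj | pj =
  s≤s (count-dropIdx₁ p xs (d ∘ suc) i di pi)
count-dropIdx₂ p (x ∷ xs) d (suc i) (suc j) i≢j di dj pi pj with d zero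
... | true  rewrite count-∷ p x xs =
  ≤-trans (count-dropIdx₂ p xs (d ∘ suc) i j (i≢j ∘ cong suc) di dj pi pj) (m≤n+m _ (indicator (p x)))
... | false rewrite count-∷ p x xs | count-∷ p x (dropIdx xs (d ∘ suc))
  | sym (+-suc (indicator (p x)) (count p (dropIdx xs (d ∘ suc))))
  | sym (+-suc (indicator (p x)) (suc (count p (dropIdx xs (d ∘ suc))))) =
  +-monoʳ-≤ (indicator (p x)) (count-dropIdx₂ p xs (d ∘ suc) i j (i≢j ∘ cong suc) di dj pi pj)

count-++ : {A : Set} (p : A → Bool) (xs ys : List A) → count p (xs ++ ys) ≡ count p xs + count p ys
count-++ p []       ys = refl
count-++ p (x ∷ xs) ys rewrite count-∷ p x (xs ++ ys) | count-∷ p x xs | count-++ p xs ys =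
  sym (+-assoc (indicator (p x)) _ _)

otherEnd-joins : ∀ {n} {s : Fin n} (G : Graph n) e → AtS G s e →
  Joins G e s (otherEnd s (ends G e))
otherEnd-joins {s = s} G e at with ends G e
... | (a , b) with a ≟ s
...   | yes refl = inj₁ refl
otherEnd-joins G e (inj₁ refl) | (a , b) | no a≢s = contradiction refl a≢s
otherEnd-joins G e (inj₂ refl) | (a , b) | no a≢s = inj₂ refl

joins-sym : ∀ {n} {G : Graph n} {e u v} → Joins G e u v → Joins G e v u
joins-sym (inj₁ eq) = inj₂ eq
joins-sym (inj₂ eq) = inj₁ eq

joins-crosses : ∀ {n} {G : Graph n} {e u v} (X : Subset n) → Joins G e u v → u ∉ X → v ∈ X →
  crosses X (ends G e) ≡ true
joins-crosses X (inj₁ eq) u∉X v∈X rewrite eq | ∉⇒mem u∉X | ∈⇒mem v∈X = refl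
joins-crosses X (inj₂ eq) u∉X v∈X rewrite eq | ∉⇒mem u∉X | ∈⇒mem v∈X = refl

joins-links : ∀ {n} {G : Graph n} {e u v} (X Y : Subset n) → Joins G e u v → u ∈ Y → v ∈ X →
  links X Y (ends G e) ≡ true
joins-links {v = v} X Y (inj₁ eq) u∈Y v∈X rewrite eq | ∈⇒mem u∈Y | ∈⇒mem v∈X = Bool.∨-zeroʳ _
joins-links X Y (inj₂ eq) u∈Y v∈X rewrite eq | ∈⇒mem u∈Y | ∈⇒mem v∈X = refl

crosses-joins : ∀ {n} (G : Graph n) e (X : Subset n) → crosses X (ends G e) ≡ true →
  ∃ λ u → ∃ λ v → Joins G e u v × u ∉ X × v ∈ X
crosses-joins G e X h with ends G e
... | (a , b) with memᵇ a X in ha | memᵇ b X in hb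
...   | true  | false = b , a , inj₂ refl , mem⇒∉ hb , mem⇒∈ ha
...   | false | true  = a , b , inj₁ refl , mem⇒∉ ha , mem⇒∈ hb

-- Lifting two edges that enter A lowers δ(A) by 2, below k when A is dangerous.
dangerous⇒¬liftable : ∀ {n} (G : Graph n) (s : Fin n) (k : ℕ) (A : Subset n) → Dangerous G s k A →
  ∀ e f → otherEnd s (ends G e) ∈ A → otherEnd s (ends G f) ∈ A → ¬ Liftable G s k e f
dangerous⇒¬liftable {n} G s k A (ne , s∉A , out , small) e f e∈ f∈ (ate , atf , e≢f , conn) =
  <⇒≱ (s≤s⁻¹ (≤-trans lifted (≤-trans small (≤-reflexive (+-comm k 1)))))
      (connected⇒cut {G = lift G s e f} conn A s∉A ne out)
  where
  v w : Fin n
  v = otherEnd s (ends G e)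
  w = otherEnd s (ends G f)

  dropped : Edge G → Bool
  dropped i = ⌊ i ≟ e ⌋ ∨ ⌊ i ≟ f ⌋

  new : Graph n
  new = if ⌊ v ≟ w ⌋ then [] else (v , w) ∷ []

  -- The edge created by lifting has both ends in `A`, so it does not make up for the two removed
  -- edges.
  new-inside : count (crosses A) new ≡ 0
  new-inside with ⌊ v ≟ w ⌋
  ... | true  = refl
  ... | false rewrite ∈⇒mem e∈ | ∈⇒mem f∈ = refl

  dropped-e : dropped e ≡ true
  dropped-e with e ≟ e
  ... | yes _   = refl
  ... | no  e≢e = contradiction refl e≢e

  dropped-f : dropped f ≡ true
  dropped-f with f ≟ f
  ... | yes _   = Bool.∨-zeroʳ _
  ... | no  f≢f = contradiction refl f≢f

  lifted : 2 + δsize (lift G s e f) A ≤ δsize G A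
  lifted = subst (λ c → 2 + c ≤ δsize G A)
    (sym (trans (count-++ (crosses A) (dropIdx G dropped) new)
      (trans (cong (count (crosses A) (dropIdx G dropped) +_) new-inside) (+-identityʳ _))))
    (count-dropIdx₂ (crosses A) G dropped e f e≢f dropped-e dropped-f
      (joins-crosses {G = G} {e} A (otherEnd-joins G e ate) s∉A e∈)
      (joins-crosses {G = G} {f} A (otherEnd-joins G f atf) s∉A f∈))

-- Decidable subsets and tight sums

fromDec : ∀ {n} {P : Fin n → Set} → (∀ v → Dec (P v)) → Subset n
fromDec P? = tabulate (λ v → does (P? v))

∈-fromDec⁺ : ∀ {n} {P : Fin n → Set} (P? : ∀ v → Dec (P v)) {v} → P v → v ∈ fromDec P?
∈-fromDec⁺ P? {v} pv = mem⇒∈ (trans (lookup∘tabulate _ v) (dec-true (P? v) pv))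

∈-fromDec⁻ : ∀ {n} {P : Fin n → Set} (P? : ∀ v → Dec (P v)) {v} → v ∈ fromDec P? → P v
∈-fromDec⁻ P? {v} v∈ with P? v | trans (sym (lookup∘tabulate (does ∘ P?) v)) (∈⇒mem v∈)
... | yes pv | _ = pv

-- Two nonnegative slacks whose sum is at most 0 both vanish. This turns the uncrossing inequalities
-- into equalities.
squeeze : ∀ {a b a₀ b₀} → a₀ ≤ a → b₀ ≤ b → a + b ≤ a₀ + b₀ → a ≡ a₀ × b ≡ b₀
squeeze {a} {b} {a₀} {b₀} a₀≤a b₀≤b ab≤ =
  ≤-antisym (+-cancelʳ-≤ b _ _ (≤-trans ab≤ (+-monoʳ-≤ a₀ b₀≤b))) a₀≤a ,
  ≤-antisym (+-cancelˡ-≤ a _ _ (≤-trans ab≤ (+-monoˡ-≤ b₀ a₀≤a))) b₀≤b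

half-unique : ∀ {k} x r → k ≡ suc (2 * x) → k ≡ suc (2 * r) → x ≡ r
half-unique x r kx kr = *-cancelˡ-≡ x r 2 (cong pred (trans (sym kx) kr))

-- Uncrossing two dangerous sets

-- Deliberately asymmetric: the facts about `B ─ A` come from the record for the swapped pair. By
-- `outside`, every edge from `A ∩ B` that leaves `A ∪ B` goes to `s`.
record TightPair {n} (G : Graph n) (s : Fin n) (k : ℕ) (A B : Subset n) : Set where
  field
    δA      : δsize G A ≡ k + 1
    δA─B    : δsize G (A ─ B) ≡ k
    δA∩B    : δsize G (A ∩ B) ≡ k
    toS     : between G (A ∩ B) ⁅ s ⁆ ≡ 1
    outside : between G (A ∩ B) (∁ (A ∪ B) ─ ⁅ s ⁆) ≡ 0
    half    : k ≡ suc (2 * between G (A ∩ B) (A ─ B))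

-- Every inequality used in uncrossing A and B is forced to be an equality.
tightPair : ∀ {n} (G : Graph n) (s : Fin n) (k : ℕ) (A B : Subset n) → s ∉ A → s ∉ B →
  δsize G A ≤ k + 1 → δsize G B ≤ k + 1 → k ≤ δsize G (A ─ B) → k ≤ δsize G (B ─ A) →
  k ≤ δsize G (A ∩ B) → k + 2 ≤ δsize G (A ∪ B) → 1 ≤ between G (A ∩ B) ⁅ s ⁆ →
  TightPair G s k A B
tightPair {n} G s k A B s∉A s∉B A≤ B≤ P≥ Q≥ X≥ U≥ sX≥ = record
  { δA      = sym (proj₁ sides)
  ; δA─B    = δP
  ; δA∩B    = δX
  ; toS     = proj₁ exits
  ; outside = proj₂ exits
  -- `δsize-split` now reads `k + k ≡ (k + 1) + 2 * x`; cancelling `k` shows that `k` is odd.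
  ; half    = +-cancelˡ-≡ k _ _ (trans (cong₂ _+_ (sym δP) (sym δX)) (trans (δsize-split G A B)
                (trans (cong (_+ 2 * between G (A ∩ B) (A ─ B)) (sym (proj₁ sides))) (+-assoc k 1 _))))
  }
  where
  Out : Subset n
  Out = ∁ (A ∪ B)

  Out∩s : Out ∩ ⁅ s ⁆ ≡ ⁅ s ⁆
  Out∩s = ⊆-antisym (p∩q⊆q Out ⁅ s ⁆) λ {x} x∈ →
    x∈p∩q⁺ (x∉p⇒x∈∁p (λ x∈∪ → s∉∪ (subst (_∈ A ∪ B) (x∈⁅y⁆⇒x≡y s x∈) x∈∪)) , x∈)
    where
    s∉∪ : s ∉ A ∪ B
    s∉∪ s∈ with x∈p∪q⁻ A B s∈
    ... | inj₁ s∈A = s∉A s∈A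
    ... | inj₂ s∈B = s∉B s∈B

  split : between G (A ∩ B) ⁅ s ⁆ + between G (A ∩ B) (Out ─ ⁅ s ⁆) ≤ between G (A ∩ B) Out
  split = subst (λ T → between G (A ∩ B) T + between G (A ∩ B) (Out ─ ⁅ s ⁆) ≤ between G (A ∩ B) Out)
    Out∩s (between-split G A B ⁅ s ⁆)

  out≥1 : 1 ≤ between G (A ∩ B) Out
  out≥1 = ≤-trans sX≥ (≤-trans (m≤m+n _ _) split)

  sum≤ : δsize G A + δsize G B ≤ (k + k) + 2
  sum≤ = ≤-trans (+-mono-≤ A≤ B≤) (≤-reflexive (interchange k 1 k 1))

  -- The differences take at least `k + k` and the doubled outgoing edges at least 2, which exhausts
  -- the bound `(k + k) + 2`.
  posi : δsize G (A ─ B) + δsize G (B ─ A) ≡ k + k × 2 * between G (A ∩ B) Out ≡ 2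
  posi = squeeze (+-mono-≤ P≥ Q≥) (*-monoʳ-≤ 2 out≥1) (≤-trans (posimodular G A B) sum≤)

  δP : δsize G (A ─ B) ≡ k
  δP = proj₁ (squeeze P≥ Q≥ (≤-reflexive (proj₁ posi)))

  -- Submodularity exhausts the same bound with `k` for the intersection and `k + 2` for the union.
  δX : δsize G (A ∩ B) ≡ k
  δX = proj₁ (squeeze X≥ U≥ (≤-trans (submodular G A B) (≤-trans sum≤ (≤-reflexive (+-assoc k k 2)))))

  exits : between G (A ∩ B) ⁅ s ⁆ ≡ 1 × between G (A ∩ B) (Out ─ ⁅ s ⁆) ≡ 0
  exits = squeeze sX≥ z≤n (≤-trans split (≤-reflexive (*-cancelˡ-≡ _ 1 2 (proj₂ posi))))

  -- Read in the other direction, posimodularity bounds the sum of the two cuts below by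
  -- `(k + 1) + (k + 1)`, so neither falls short of its upper bound.
  sides : k + 1 ≡ δsize G A × k + 1 ≡ δsize G B
  sides = squeeze A≤ B≤ (≤-trans
    (≤-reflexive (trans (interchange k 1 k 1) (sym (cong₂ _+_ (proj₁ posi) (proj₂ posi)))))
    (posimodular G A B))

-- The targets `A ∩ B`, `⁅ s ⁆` and `R` are pairwise disjoint and lie outside `A ─ B`, so no edge of
-- its cut is counted twice. `R` will be the set of vertices in no `A i`.
endBlob-bound : ∀ {n} (G : Graph n) (s : Fin n) (A B R : Subset n) → s ∉ A → s ∉ R →
  (∀ {v} → v ∈ R → v ∉ A) →
  between G (A ∩ B) (A ─ B) + (between G (A ─ B) ⁅ s ⁆ + between G R (A ─ B)) ≤ δsize G (A ─ B)
endBlob-bound {n} G s A B R s∉A s∉R R∩A =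
  subst₂ _≤_
    (cong (λ x → between G (A ∩ B) (A ─ B) + (between G (A ─ B) ⁅ s ⁆ + x)) (+-identityʳ _))
    (+-identityʳ _)
    (totalCount-mono parts whole G λ i → pointwise (lookup G i))
  where
  parts whole : List (Fin n × Fin n → Bool)
  parts = links (A ∩ B) (A ─ B) ∷ links (A ─ B) ⁅ s ⁆ ∷ links R (A ─ B) ∷ []
  whole = crosses (A ─ B) ∷ []

  -- The bit patterns excluded by the disjointness of `A`, `⁅ s ⁆` and `R`; the truth table is
  -- required to hold only on the remaining ones.
  clash : Bool → Bool → Bool → Bool
  clash a σ ρ = (a ∧ σ) ∨ (ρ ∧ (a ∨ σ))

  noClash : ∀ v → clash (memᵇ v A) (memᵇ v ⁅ s ⁆) (memᵇ v R) ≡ false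
  noClash v with v ∈? R | v ∈? ⁅ s ⁆
  ... | yes v∈R | yes v∈s = ⊥-elim (s∉R (subst (_∈ R) (x∈⁅y⁆⇒x≡y s v∈s) v∈R))
  ... | yes v∈R | no  v∉s rewrite ∈⇒mem v∈R | ∉⇒mem v∉s | ∉⇒mem (R∩A v∈R) = refl
  ... | no  v∉R | yes v∈s rewrite ∉⇒mem v∉R | ∈⇒mem v∈s
    | ∉⇒mem (λ v∈A → s∉A (subst (_∈ A) (x∈⁅y⁆⇒x≡y s v∈s) v∈A)) = refl
  ... | no  v∉R | no  v∉s rewrite ∉⇒mem v∉R | ∉⇒mem v∉s = trans (Bool.∨-identityʳ _) (Bool.∧-zeroʳ _)

  pointwise : ∀ p → weight parts p ≤ weight whole p
  pointwise (u , v) rewrite mem-∩ A B u | mem-∩ A B v | mem-─ A B u | mem-─ A B v =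
    toWitness {a? = ∀Bool? λ a → ∀Bool? λ b → ∀Bool? λ σ → ∀Bool? λ ρ →
                    ∀Bool? λ a′ → ∀Bool? λ b′ → ∀Bool? λ σ′ → ∀Bool? λ ρ′ →
      (clash a σ ρ Bool.≟ false) →-dec ((clash a′ σ′ ρ′ Bool.≟ false) →-dec
      (indicator (((a ∧ b) ∧ (a′ ∧ not b′)) ∨ ((a′ ∧ b′) ∧ (a ∧ not b)))
        + (indicator (((a ∧ not b) ∧ σ′) ∨ ((a′ ∧ not b′) ∧ σ))
        + (indicator ((ρ ∧ (a′ ∧ not b′)) ∨ (ρ′ ∧ (a ∧ not b))) + 0))
        ≤? indicator ((a ∧ not b) xor (a′ ∧ not b′)) + 0))} tt
      (memᵇ u A) (memᵇ u B) (memᵇ u ⁅ s ⁆) (memᵇ u R)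
      (memᵇ v A) (memᵇ v B) (memᵇ v ⁅ s ⁆) (memᵇ v R) (noClash u) (noClash v)

-- Cyclic and linear orders of indices

nextC-last : ∀ {m i} → suc i ≡ m → nextC m i ≡ 0
nextC-last {m} {i} eq with suc i ≡ᵇ m | ≡⇒≡ᵇ (suc i) m eq
... | true | _ = refl

nextC-suc : ∀ {m i} → suc i < m → nextC m i ≡ suc i
nextC-suc {m} {i} lt with suc i ≡ᵇ m | ≡ᵇ⇒≡ (suc i) m
... | false | _  = refl
... | true  | eq = contradiction (eq tt) (<⇒≢ lt)

nextC-cases : ∀ {m i} → i < m → (suc i ≡ m × nextC m i ≡ 0) ⊎ (suc i < m × nextC m i ≡ suc i)
nextC-cases {m} i<m with m≤n⇒m<n∨m≡n i<m
... | inj₁ lt = inj₂ (lt , nextC-suc lt)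
... | inj₂ eq = inj₁ (eq , nextC-last eq)

nextC-< : ∀ {m i} → i < m → nextC m i < m
nextC-< i<m with nextC-cases i<m
... | inj₁ (_  , eq) rewrite eq = ≤-trans (s≤s z≤n) i<m
... | inj₂ (lt , eq) rewrite eq = lt

nextC-≢ : ∀ {m i} → 2 ≤ m → i < m → i ≢ nextC m i
nextC-≢ 2≤m i<m with nextC-cases i<m
... | inj₁ (refl , eq) rewrite eq = λ { refl → contradiction 2≤m λ { (s≤s ()) } }
... | inj₂ (_    , eq) rewrite eq = λ ()

nextC²-≢ : ∀ {m i} → 3 ≤ m → i < m → i ≢ nextC m (nextC m i)
nextC²-≢ 3≤m i<m with nextC-cases i<m
... | inj₁ (refl , eq) rewrite eq | nextC-suc (≤-trans (s≤s (s≤s z≤n)) 3≤m) =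
  λ { refl → contradiction 3≤m λ { (s≤s (s≤s ())) } }
... | inj₂ (lt , eq) rewrite eq with nextC-cases lt
...   | inj₁ (refl , eq′) rewrite eq′ = λ { refl → contradiction 3≤m λ { (s≤s (s≤s ())) } }
...   | inj₂ (_    , eq′) rewrite eq′ = λ ()

-- False for `m = 3`, where three steps return to the start; this is why that length is excluded
-- separately.
nextC³-≢ : ∀ {m i} → 4 ≤ m → i < m → i ≢ nextC m (nextC m (nextC m i))
nextC³-≢ 4≤m i<m with nextC-cases i<m
... | inj₁ (refl , eq) rewrite eq | nextC-suc (≤-trans (s≤s (s≤s z≤n)) 4≤m)
  | nextC-suc (≤-trans (s≤s (s≤s (s≤s z≤n))) 4≤m) =
  λ { refl → contradiction 4≤m λ { (s≤s (s≤s (s≤s ()))) } }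
... | inj₂ (lt , eq) rewrite eq with nextC-cases lt
...   | inj₁ (refl , eq′) rewrite eq′ | nextC-suc (≤-trans (s≤s (s≤s z≤n)) 4≤m) =
  λ { refl → contradiction 4≤m λ { (s≤s (s≤s (s≤s ()))) } }
...   | inj₂ (lt′ , eq′) rewrite eq′ with nextC-cases lt′
...     | inj₁ (refl , eq″) rewrite eq″ = λ { refl → contradiction 4≤m λ { (s≤s (s≤s (s≤s ()))) } }
...     | inj₂ (_    , eq″) rewrite eq″ = λ ()

prevC-< : ∀ {m i} → i < m → prevC m i < m
prevC-< {suc m} {zero}  _   = ≤-refl
prevC-< {m}     {suc i} i<m = <-trans ≤-refl i<m

nextC-prevC : ∀ {m i} → i < m → nextC m (prevC m i) ≡ i
nextC-prevC {suc m} {zero}  _   = nextC-last {suc m} {m} refl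
nextC-prevC {m}     {suc i} i<m = nextC-suc i<m

module _ {n} {m : ℕ} (A : ℕ → Subset n) where

  pathBlobs-inner : ∀ {j} → suc j < m → pathBlobs m A (suc j) ≡ A j ∩ A (suc j)
  pathBlobs-inner {j} lt with suc j ≡ᵇ m | ≡ᵇ⇒≡ (suc j) m
  ... | false | _  = refl
  ... | true  | eq = contradiction (eq tt) (<⇒≢ lt)

  -- The index has the form `suc (suc l)` so that the truncated `j ∸ 1` in `pathBlobs` computes to
  -- `l`.
  pathBlobs-last : ∀ {l} → suc (suc l) ≡ m → pathBlobs m A (suc (suc l)) ≡ A (suc l) ─ A l
  pathBlobs-last {l} eq with suc (suc l) ≡ᵇ m | ≡⇒≡ᵇ (suc (suc l)) m eq
  ... | true | _ = refl

-- Independent sets of the lifting graph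

firstStep : {A : Set} {R : A → A → Set} {x y : A} → Star R x y → y ≢ x → ∃ λ z → R x z
firstStep ε        y≢x = contradiction refl y≢x
firstStep (r ◅ rs) y≢x = _ , r

-- `Liftable` is not shown to be decidable, so the extension is found only up to double negation. By
-- induction on `⊃`, a strictly larger independent set would have a maximal extension, which also
-- extends `F`; if there is none, `F` is itself maximal.
¬¬-extendToMaximal : ∀ {n} (G : Graph n) (s : Fin n) (k : ℕ) (F : Subset (length G)) →
  Independent G s k F → ¬ ¬ (∃ λ F′ → MaximalIndependent G s k F′ × F ⊆ F′)
¬¬-extendToMaximal G s k F = go F (⊃-wellFounded F)
  where
  go : ∀ F → Acc _⊃_ F → Independent G s k F → ¬ ¬ (∃ λ F′ → MaximalIndependent G s k F′ × F ⊆ F′)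
  go F (acc rec) ind none = none (F , (ind , maximal) , λ e∈F → e∈F)
    where
    maximal : ∀ F′ → Independent G s k F′ → F ⊆ F′ → F′ ⊆ F
    maximal F′ ind′ F⊆F′ {e} e∈F′ with e ∈? F
    ... | yes e∈F = e∈F
    ... | no  e∉F = ⊥-elim (go F′ (rec (F⊆F′ , e , e∈F′ , e∉F)) ind′
      λ { (F″ , max , F′⊆F″) → none (F″ , max , λ e∈F → F′⊆F″ (F⊆F′ e∈F)) })

record LiftingData {n} (G : Graph n) (s : Fin n) (k m : ℕ)
                   (I : ℕ → Subset (length G)) (A : ℕ → Subset n) : Set where
  field
    loopless    : Loopless G
    conn        : SKEdgeConnected G s k
    deg≥2       : 2 ≤ deg G s
    L-connected : ConnectedOnAtS G s (Liftable G s k)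
    enum        : EnumeratesMIS G s k m I
    corr        : ∀ i → i < m → CorrespondingDangerous G s k (I i) (A i)

module LiftingGraph {n} {G : Graph n} {s : Fin n} {k m : ℕ}
  {I : ℕ → Subset (length G)} {A : ℕ → Subset n} (𝓛 : LiftingData G s k m I A) where

  open LiftingData 𝓛

  end : Edge G → Fin n
  end e = otherEnd s (ends G e)

  atS? : ∀ e → Dec (AtS G s e)
  atS? e = (proj₁ (ends G e) ≟ s) ⊎-dec (proj₂ (ends G e) ≟ s)

  joins-loop : ∀ {e} → ¬ Joins G e s s
  joins-loop {e} j = All.lookup loopless (∈-lookup e) (equalEnds j)
    where
    equalEnds : Joins G e s s → proj₁ (ends G e) ≡ proj₂ (ends G e)
    equalEnds (inj₁ eq) rewrite eq = refl
    equalEnds (inj₂ eq) rewrite eq = refl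

  end≢s : ∀ {e} → AtS G s e → end e ≢ s
  end≢s {e} at eq = joins-loop {e} (subst (Joins G e s) eq (otherEnd-joins G e at))

  joins-atS : ∀ {e v} → Joins G e s v → AtS G s e
  joins-atS (inj₁ eq) = inj₁ (cong proj₁ eq)
  joins-atS (inj₂ eq) = inj₂ (cong proj₂ eq)

  joins-end : ∀ {e v} → v ≢ s → Joins G e s v → end e ≡ v
  joins-end {e} v≢s (inj₁ eq) rewrite eq with s ≟ s
  ... | yes _   = refl
  ... | no  s≢s = contradiction refl s≢s
  joins-end {e} {v} v≢s (inj₂ eq) rewrite eq with v ≟ s
  ... | yes v≡s = contradiction v≡s v≢s
  ... | no  _   = refl

  module _ {i} (i<m : i < m) where

    maximalI : MaximalIndependent G s k (I i)
    maximalI = proj₁ enum i i<m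

    I⇒atS : ∀ {e} → e ∈ I i → AtS G s e
    I⇒atS {e} = proj₁ (proj₁ maximalI) e

    dangerousA : Dangerous G s k (A i)
    dangerousA = proj₁ (corr i i<m)

    s∉A : s ∉ A i
    s∉A = proj₁ (proj₂ dangerousA)

    A-outside : ∃ λ v → v ≢ s × v ∉ A i
    A-outside = proj₁ (proj₂ (proj₂ dangerousA))

    δA≤ : δsize G (A i) ≤ k + 1
    δA≤ = proj₂ (proj₂ (proj₂ dangerousA))

    I⇒end∈A : ∀ {e} → e ∈ I i → end e ∈ A i
    I⇒end∈A {e} = proj₁ (proj₂ (corr i i<m)) e

    -- The edges of `s` ending in a dangerous set are pairwise non-liftable, and here they include
    -- `I i`, so maximality applies. With `X = A i` this describes `I i` exactly; with `X` a union
    -- it shows that the union is not dangerous.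
    dangerous⊇⇒∈I : ∀ {X} → Dangerous G s k X → A i ⊆ X → ∀ {e} → AtS G s e → end e ∈ X → e ∈ I i
    dangerous⊇⇒∈I {X} dang A⊆X {e} at e∈X = proj₂ maximalI F
      ((λ f f∈ → proj₁ (∈-fromDec⁻ F? f∈)) ,
       λ f g f∈ g∈ → dangerous⇒¬liftable G s k X dang f g
         (proj₂ (∈-fromDec⁻ F? f∈)) (proj₂ (∈-fromDec⁻ F? g∈)))
      (λ {f} f∈I → ∈-fromDec⁺ F? (I⇒atS f∈I , A⊆X (I⇒end∈A f∈I)))
      (∈-fromDec⁺ F? (at , e∈X))
      where
      F? : ∀ f → Dec (AtS G s f × end f ∈ X)
      F? f = atS? f ×-dec (end f ∈? X)

      F : Subset (length G)
      F = fromDec F?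

    end∈A⇒I : ∀ {e} → AtS G s e → end e ∈ A i → e ∈ I i
    end∈A⇒I = dangerous⊇⇒∈I dangerousA (λ v∈A → v∈A)

    subset-cut : ∀ {X} → X ⊆ A i → Nonempty X → k ≤ δsize G X
    subset-cut {X} X⊆A ne with A-outside
    ... | v , v≢s , v∉A = connected⇒cut {G = G} conn X (s∉A ∘ X⊆A) ne (v , v≢s , v∉A ∘ X⊆A)

    s-edge-into : ∀ {X e} → e ∈ I i → end e ∈ X → 1 ≤ between G X ⁅ s ⁆
    s-edge-into {X} {e} e∈I e∈X = count-positive (links X ⁅ s ⁆) G e
      (joins-links {G = G} {e} X ⁅ s ⁆ (otherEnd-joins G e (I⇒atS e∈I)) (x∈⁅x⁆ s) e∈X)

  hit⇒atS : ∀ f → ⌊ proj₁ (ends G f) ≟ s ⌋ ∨ ⌊ proj₂ (ends G f) ≟ s ⌋ ≡ true → AtS G s f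
  hit⇒atS f h with proj₁ (ends G f) ≟ s | proj₂ (ends G f) ≟ s
  ... | yes p | _     = inj₁ p
  ... | no  _ | yes q = inj₂ q

  -- A connected graph with at least two vertices has no isolated vertex: take the first step of a
  -- walk to a second edge of `s`.
  liftablePartner : ∀ {e} → AtS G s e → ∃ λ g → Liftable G s k e g
  liftablePartner {e} at with count⇒otherHit _ G deg≥2 e
  ... | f , f≢e , hit = firstStep (L-connected e f at (hit⇒atS f hit)) f≢e

  liftable⇒∉I : ∀ {i e g} → i < m → e ∈ I i → Liftable G s k e g → g ∉ I i
  liftable⇒∉I i<m e∈I lift g∈I = proj₂ (proj₁ (maximalI i<m)) _ _ e∈I g∈I lift

  -- Membership in one of the `m` listed sets is decidable, which removes the double negation from
  -- `¬¬-extendToMaximal`.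
  edge∈someI : ∀ {e} → AtS G s e → ∃ λ i → i < m × e ∈ I i
  edge∈someI {e} at with anyUpTo? (λ i → e ∈? I i) m
  ... | yes found = found
  ... | no  none  = ⊥-elim (¬¬-extendToMaximal G s k ⁅ e ⁆ singleton λ { (F , max , e⊆F) →
    let (i , i<m , eq) = proj₁ (proj₂ enum) F max
    in none (i , i<m , subst (e ∈_) (sym eq) (e⊆F (x∈⁅x⁆ e))) })
    where
    singleton : Independent G s k ⁅ e ⁆
    singleton =
      (λ f f∈ → subst (AtS G s) (sym (x∈⁅y⁆⇒x≡y e f∈)) at) ,
      λ f g f∈ g∈ lift → proj₁ (proj₂ (proj₂ lift)) (trans (x∈⁅y⁆⇒x≡y e f∈) (sym (x∈⁅y⁆⇒x≡y e g∈)))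

  privateEdge : ∀ {i j} → i < m → j < m → i ≢ j → ∃ λ e → e ∈ I i × e ∉ I j
  privateEdge {i} {j} i<m j<m i≢j with any? (λ e → (e ∈? I i) ×-dec ¬? (e ∈? I j))
  ... | yes found = found
  ... | no  none  = ⊥-elim (proj₂ (proj₂ enum) i j i<m j<m i≢j
    (⊆-antisym I⊆ (proj₂ (maximalI i<m) (I j) (proj₁ (maximalI j<m)) I⊆)))
    where
    I⊆ : I i ⊆ I j
    I⊆ {e} e∈ with e ∈? I j
    ... | yes e∈j = e∈j
    ... | no  e∉j = ⊥-elim (none (e , e∈ , e∉j))

  private∈A─A : ∀ {i j e} (i<m : i < m) (j<m : j < m) → e ∈ I i → e ∉ I j → end e ∈ A i ─ A j
  private∈A─A i<m j<m e∈ e∉ =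
    x∈p∧x∉q⇒x∈p─q (I⇒end∈A i<m e∈) (e∉ ∘ end∈A⇒I j<m (I⇒atS i<m e∈))

  -- If the union were dangerous, `I i` and `I j` would each contain every edge of `s` ending in it,
  -- hence each other.
  union-δ : ∀ {i j} → i < m → j < m → i ≢ j → (∃ λ v → v ≢ s × v ∉ A i ∪ A j) →
    k + 2 ≤ δsize G (A i ∪ A j)
  union-δ {i} {j} i<m j<m i≢j out with δsize G (A i ∪ A j) ≤? k + 1
  ... | no  big   = ≤-trans (≤-reflexive (+-suc k 1)) (≰⇒> big)
  ... | yes small = ⊥-elim (proj₂ (proj₂ enum) i j i<m j<m i≢j (⊆-antisym
    (λ e∈ → dangerous⊇⇒∈I j<m dang (q⊆p∪q (A i) (A j)) (I⇒atS i<m e∈) (p⊆p∪q (A j) (I⇒end∈A i<m e∈)))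
    (λ e∈ → dangerous⊇⇒∈I i<m dang (p⊆p∪q (A j)) (I⇒atS j<m e∈) (q⊆p∪q (A i) (A j) (I⇒end∈A j<m e∈)))))
    where
    s∉ : s ∉ A i ∪ A j
    s∉ s∈ with x∈p∪q⁻ (A i) (A j) s∈
    ... | inj₁ s∈i = s∉A i<m s∈i
    ... | inj₂ s∈j = s∉A j<m s∈j

    dang : Dangerous G s k (A i ∪ A j)
    dang with privateEdge i<m j<m i≢j
    ... | e , e∈ , _ = (end e , p⊆p∪q (A j) (I⇒end∈A i<m e∈)) , s∉ , out , small

  -- Pairs of meeting and of disjoint independent sets

  record Meeting (i j : ℕ) : Set where
    constructor meeting
    field
      i<m  : i < m
      j<m  : j < m
      i≢j  : i ≢ j
      meet : Meet (I i) (I j)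

  swap : ∀ {i j} → Meeting i j → Meeting j i
  swap {i} {j} (meeting i<m j<m i≢j meet) =
    meeting j<m i<m (i≢j ∘ sym) (subst Nonempty (∩-comm (I i) (I j)) meet)

  -- The lower bounds for `tightPair` come from four edges of `s`: the private edges `f` and `h` end
  -- in the two differences, the common edge `e` in the intersection, and its partner `g` outside
  -- the union.
  meeting⇒tight : ∀ {i j} → Meeting i j → TightPair G s k (A i) (A j)
  meeting⇒tight {i} {j} (meeting i<m j<m i≢j (e , e∈)) with x∈p∩q⁻ (I i) (I j) e∈
  ... | e∈i , e∈j with liftablePartner (I⇒atS i<m e∈i)
                     | privateEdge i<m j<m i≢j | privateEdge j<m i<m (i≢j ∘ sym)
  ...   | g , lift | f , f∈i , f∉j | h , h∈j , h∉i =
    tightPair G s k (A i) (A j) (s∉A i<m) (s∉A j<m) (δA≤ i<m) (δA≤ j<m)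
      (subset-cut i<m (p─q⊆p (A i) (A j)) (end f , private∈A─A i<m j<m f∈i f∉j))
      (subset-cut j<m (p─q⊆p (A j) (A i)) (end h , private∈A─A j<m i<m h∈j h∉i))
      (subset-cut i<m (p∩q⊆p (A i) (A j)) (end e , end∈))
      (union-δ i<m j<m i≢j (end g , end≢s (proj₁ (proj₂ lift)) , g∉))
      (s-edge-into i<m e∈i end∈)
    where
    end∈ : end e ∈ A i ∩ A j
    end∈ = x∈p∩q⁺ (I⇒end∈A i<m e∈i , I⇒end∈A j<m e∈j)

    g∉ : end g ∉ A i ∪ A j
    g∉ g∈ with x∈p∪q⁻ (A i) (A j) g∈
    ... | inj₁ g∈A = liftable⇒∉I i<m e∈i lift (end∈A⇒I i<m (proj₁ (proj₂ lift)) g∈A)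
    ... | inj₂ g∈A = liftable⇒∉I j<m e∈j lift (end∈A⇒I j<m (proj₁ (proj₂ lift)) g∈A)

  meeting⇒nonempty : ∀ {i j} → Meeting i j → Nonempty (A i ∩ A j)
  meeting⇒nonempty {i} {j} (meeting i<m j<m _ (e , e∈)) with x∈p∩q⁻ (I i) (I j) e∈
  ... | e∈i , e∈j = end e , x∈p∩q⁺ (I⇒end∈A i<m e∈i , I⇒end∈A j<m e∈j)

  difference-nonempty : ∀ {i j} → i < m → j < m → i ≢ j → Nonempty (A i ─ A j)
  difference-nonempty i<m j<m i≢j with privateEdge i<m j<m i≢j
  ... | e , e∈ , e∉ = end e , private∈A─A i<m j<m e∈ e∉

  meeting⇒noExit : ∀ {i j} → Meeting i j → ∀ {e u v} → Joins G e u v → v ∈ A i → v ∈ A j →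
    u ∉ A i → u ∉ A j → u ≢ s → ⊥
  meeting⇒noExit {i} {j} mt {e} {u} {v} joins v∈i v∈j u∉i u∉j u≢s =
    contradiction (count-positive (links (A i ∩ A j) Out) G e
        (joins-links {G = G} {e} (A i ∩ A j) Out joins u∈Out (x∈p∩q⁺ (v∈i , v∈j))))
      λ pos → <⇒≢ pos (sym (TightPair.outside (meeting⇒tight mt)))
    where
    Out : Subset n
    Out = ∁ (A i ∪ A j) ─ ⁅ s ⁆

    u∉∪ : u ∉ A i ∪ A j
    u∉∪ u∈ with x∈p∪q⁻ (A i) (A j) u∈
    ... | inj₁ u∈i = u∉i u∈i
    ... | inj₂ u∈j = u∉j u∈j

    u∈Out : u ∈ Out
    u∈Out = x∈p∧x∉q⇒x∈p─q (x∉p⇒x∈∁p u∉∪) (x≢y⇒x∉⁅y⁆ u≢s)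

  -- The counts towards the two differences come from `half` for the two orders of the pair. That
  -- these differences are the adjacent blobs (up to vertices elsewhere in the graph) is left to
  -- `neighbour-blob`.
  meeting⇒blob : ∀ {i j r} → Meeting i j → k ≡ suc (2 * r) →
    BlobCondition G s r (A i ∩ A j) (A i ─ A j) (A j ─ A i)
  meeting⇒blob {i} {j} {r} mt kr =
    trans (TightPair.δA∩B pair) kr , TightPair.toS pair ,
    half-unique _ r (TightPair.half pair) kr ,
    trans (cong (λ X → between G X (A j ─ A i)) (∩-comm (A i) (A j)))
      (half-unique _ r (TightPair.half (meeting⇒tight (swap mt))) kr)
    where
    pair : TightPair G s k (A i) (A j)
    pair = meeting⇒tight mt

  -- As `I i` and `I j` share no edge, `A i ─ A j` still contains all ends of `I i`; if it is
  -- dangerous, minimality of `A i` applies.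
  shrink : ∀ {i j} → i < m → j < m → i ≢ j → ¬ Meet (I i) (I j) → δsize G (A i ─ A j) ≤ k + 1 →
    A i ⊆ A i ─ A j
  shrink {i} {j} i<m j<m i≢j ¬meet small with A-outside i<m
  ... | v , v≢s , v∉A = proj₂ (proj₂ (corr i i<m)) (A i ─ A j)
    (difference-nonempty i<m j<m i≢j , s∉A i<m ∘ p─q⊆p (A i) (A j) ,
      (v , v≢s , v∉A ∘ p─q⊆p (A i) (A j)) , small)
    (λ e e∈i → private∈A─A i<m j<m e∈i (λ e∈j → ¬meet (e , x∈p∩q⁺ (e∈i , e∈j))))
    (p─q⊆p (A i) (A j))

  -- By posimodularity A i ─ A j or A j ─ A i is dangerous; it still contains all the
  -- required ends, so minimality makes the intersection empty.
  disjoint : ∀ {i j} → i < m → j < m → i ≢ j → ¬ Meet (I i) (I j) → ∀ {v} → v ∈ A i → v ∉ A j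
  disjoint {i} {j} i<m j<m i≢j ¬meet {v} v∈i v∈j
    with δsize G (A i ─ A j) ≤? k + 1 | δsize G (A j ─ A i) ≤? k + 1
  ... | yes small | _ = x∈p─q⇒x∉q (A i) (A j) (shrink i<m j<m i≢j ¬meet small v∈i) v∈j
  ... | no  big   | yes small = x∈p─q⇒x∉q (A j) (A i) (shrink j<m i<m (i≢j ∘ sym)
    (¬meet ∘ subst Nonempty (∩-comm (I j) (I i))) small v∈j) v∈i
  ... | no  big   | no  big′ = <⇒≱ (+-mono-< (≰⇒> big) (≰⇒> big′))
    (≤-trans (m≤m+n _ _) (≤-trans (posimodular G (A i) (A j)) (+-mono-≤ (δA≤ i<m) (δA≤ j<m))))

  -- Submodularity for A i ─ A p and A i ─ A q, whose union is A i, gives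
  -- δ(A i ─ (A p ∪ A q)) ≤ k + k - (k + 1) < k.
  neighbours-cover : ∀ {p i q} → Meeting i p → Meeting i q → (∀ {v} → v ∈ A p → v ∉ A q) →
    ∀ {v} → v ∈ A i → v ∉ A p → v ∈ A q
  neighbours-cover {p} {i} {q} mp mq p∩q {v} v∈i v∉p with v ∈? A q
  ... | yes v∈q = v∈q
  ... | no  v∉q = ⊥-elim (<⇒≱ (+-monoʳ-< k (≤-reflexive (+-comm 1 k))) (begin
    k + (k + 1)                       ≤⟨ +-monoˡ-≤ (k + 1) (subset-cut (Meeting.i<m mp)
                                           (λ x∈ → p─q⊆p (A i) (A p) (p∩q⊆p X Y x∈))
                                           (v , x∈p∩q⁺ (x∈p∧x∉q⇒x∈p─q v∈i v∉p , x∈p∧x∉q⇒x∈p─q v∈i v∉q))) ⟩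
    δsize G (X ∩ Y) + (k + 1)         ≡⟨ cong (δsize G (X ∩ Y) +_) (sym (TightPair.δA (meeting⇒tight mp))) ⟩
    δsize G (X ∩ Y) + δsize G (A i)   ≡⟨ cong (λ Z → δsize G (X ∩ Y) + δsize G Z) (sym X∪Y) ⟩
    δsize G (X ∩ Y) + δsize G (X ∪ Y) ≤⟨ submodular G X Y ⟩
    δsize G X + δsize G Y             ≡⟨ cong₂ _+_ (TightPair.δA─B (meeting⇒tight mp))
                                                   (TightPair.δA─B (meeting⇒tight mq)) ⟩
    k + k                             ∎))
    where
    open ≤-Reasoning

    X Y : Subset n
    X = A i ─ A p
    Y = A i ─ A q

    X∪Y⊆ : X ∪ Y ⊆ A i
    X∪Y⊆ x∈ with x∈p∪q⁻ X Y x∈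
    ... | inj₁ x∈X = p─q⊆p (A i) (A p) x∈X
    ... | inj₂ x∈Y = p─q⊆p (A i) (A q) x∈Y

    -- `A p` and `A q` are disjoint, so no vertex of `A i` is removed from both differences.
    ⊆X∪Y : A i ⊆ X ∪ Y
    ⊆X∪Y {x} x∈ with x ∈? A p
    ... | yes x∈p = q⊆p∪q X Y (x∈p∧x∉q⇒x∈p─q x∈ (p∩q x∈p))
    ... | no  x∉p = p⊆p∪q Y (x∈p∧x∉q⇒x∈p─q x∈ x∉p)

    X∪Y : X ∪ Y ≡ A i
    X∪Y = ⊆-antisym X∪Y⊆ ⊆X∪Y

  -- `A i` is the disjoint union of its parts in `A p` and `A q`. This translates the differences of
  -- `meeting⇒blob` into the intersections that serve as blobs.
  neighbour-blob : ∀ {p i q} → Meeting i p → Meeting i q → (∀ {v} → v ∈ A p → v ∉ A q) →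
    A p ∩ A i ≡ A i ─ A q
  neighbour-blob {p} {i} {q} mp mq p∩q = ⊆-antisym
    (λ x∈ → let (x∈p , x∈i) = x∈p∩q⁻ (A p) (A i) x∈ in x∈p∧x∉q⇒x∈p─q x∈i (p∩q x∈p))
    (λ x∈ → x∈p∩q⁺ (neighbours-cover mq mp (λ x∈q x∈p → p∩q x∈p x∈q)
                      (p─q⊆p (A i) (A q) x∈) (x∈p─q⇒x∉q (A i) (A q) x∈)
                   , p─q⊆p (A i) (A q) x∈))

  -- Posimodularity for A i ─ A j and A i ─ A l: the edge of s that is in I i only is
  -- one too many.
  triangle-impossible : ∀ {i j l} → Meeting i j → Meeting i l → Meeting j l →
    (∀ {e} → AtS G s e → e ∈ I i ⊎ e ∈ I j ⊎ e ∈ I l) → ⊥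
  triangle-impossible {i} {j} {l} ij@(meeting i<m j<m _ (a , a∈)) il@(meeting _ l<m _ (b , b∈))
    (meeting _ _ _ (c , c∈)) covered
    with x∈p∩q⁻ (I i) (I j) a∈ | x∈p∩q⁻ (I i) (I l) b∈ | x∈p∩q⁻ (I j) (I l) c∈
  -- The partner `g` of `c` avoids `I j` and `I l`, so it lies in `I i` only and ends in `X ∩ Y`.
  ... | a∈i , a∈j | b∈i , b∈l | c∈j , c∈l with liftablePartner (I⇒atS j<m c∈j)
  ...   | g , c~g = <⇒≱ (m<m+n (k + k) {2} (s≤s z≤n)) (begin
    (k + k) + 2                         ≤⟨ +-mono-≤ (+-mono-≤
                                             (subset-cut i<m (p─q⊆p (A i) (A j) ∘ p─q⊆p X Y)
                                               (end b , only j<m b∈i b∉j (I⇒end∈A l<m b∈l)))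
                                             (subset-cut i<m (p─q⊆p (A i) (A l) ∘ p─q⊆p Y X)
                                               (end a , only l<m a∈i a∉l (I⇒end∈A j<m a∈j))))
                                             (*-monoʳ-≤ 2 gOut) ⟩
    δsize G (X ─ Y) + δsize G (Y ─ X) + 2 * between G (X ∩ Y) (∁ (X ∪ Y))
                                        ≤⟨ posimodular G X Y ⟩
    δsize G X + δsize G Y               ≡⟨ cong₂ _+_ (TightPair.δA─B (meeting⇒tight ij))
                                                     (TightPair.δA─B (meeting⇒tight il)) ⟩
    k + k                               ∎)
    where
    open ≤-Reasoning

    X Y : Subset n
    X = A i ─ A j
    Y = A i ─ A l

    -- The three sets cover all edges of `s`, so an edge in all of them would have no liftable
    -- partner. Hence `b` ends in `X ─ Y` and `a` in `Y ─ X`.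
    notInAll : ∀ {e} → e ∈ I i → e ∈ I j → e ∈ I l → ⊥
    notInAll e∈i e∈j e∈l with liftablePartner (I⇒atS i<m e∈i)
    ... | h , e~h with covered (proj₁ (proj₂ e~h))
    ...   | inj₁ h∈i        = liftable⇒∉I i<m e∈i e~h h∈i
    ...   | inj₂ (inj₁ h∈j) = liftable⇒∉I j<m e∈j e~h h∈j
    ...   | inj₂ (inj₂ h∈l) = liftable⇒∉I l<m e∈l e~h h∈l

    b∉j : b ∉ I j
    b∉j b∈j = notInAll b∈i b∈j b∈l

    a∉l : a ∉ I l
    a∉l = notInAll a∈i a∈j

    only : ∀ {e x y} → x < m → e ∈ I i → e ∉ I x → end e ∈ A y → end e ∈ (A i ─ A x) ─ (A i ─ A y)
    only {x = x} {y} x<m e∈i e∉x e∈y = x∈p∧x∉q⇒x∈p─q (private∈A─A i<m x<m e∈i e∉x)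
      (λ e∈ → x∈p─q⇒x∉q (A i) (A y) e∈ e∈y)

    g∈i : g ∈ I i
    g∈i with covered (proj₁ (proj₂ c~g))
    ... | inj₁ g∈          = g∈
    ... | inj₂ (inj₁ g∈j)  = ⊥-elim (liftable⇒∉I j<m c∈j c~g g∈j)
    ... | inj₂ (inj₂ g∈l)  = ⊥-elim (liftable⇒∉I l<m c∈l c~g g∈l)

    s∉X∪Y : s ∉ X ∪ Y
    s∉X∪Y s∈ with x∈p∪q⁻ X Y s∈
    ... | inj₁ s∈X = s∉A i<m (p─q⊆p (A i) (A j) s∈X)
    ... | inj₂ s∈Y = s∉A i<m (p─q⊆p (A i) (A l) s∈Y)

    gOut : 1 ≤ between G (X ∩ Y) (∁ (X ∪ Y))
    gOut = count-positive (links (X ∩ Y) (∁ (X ∪ Y))) G g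
      (joins-links {G = G} {g} (X ∩ Y) (∁ (X ∪ Y)) (otherEnd-joins G g (I⇒atS i<m g∈i))
        (x∉p⇒x∈∁p s∉X∪Y)
        (x∈p∩q⁺ (private∈A─A i<m j<m g∈i (liftable⇒∉I j<m c∈j c~g)
               , private∈A─A i<m l<m g∈i (liftable⇒∉I l<m c∈l c~g))))

  -- The vertices lying in no dangerous set

  rest? : ∀ v → Dec (v ≢ s × ¬ (∃ λ i → i < m × v ∈ A i))
  rest? v = ¬? (v ≟ s) ×-dec ¬? (anyUpTo? (λ i → v ∈? A i) m)

  rest : Subset n
  rest = fromDec rest?

  s∉rest : s ∉ rest
  s∉rest s∈ = proj₁ (∈-fromDec⁻ rest? s∈) refl

  rest-cut : 0 < m → Nonempty rest → k ≤ δsize G rest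
  rest-cut 0<m ne with dangerousA 0<m
  ... | (v , v∈A) , s∉ , _ = connected⇒cut {G = G} conn rest s∉rest ne
    (v , (λ { refl → s∉ v∈A }) , λ v∈ → proj₂ (∈-fromDec⁻ rest? v∈) (0 , 0<m , v∈A))

  -- The outer end cannot be `s`: every edge of `s` lies in some `I i` and so ends in `A i`, not in
  -- `rest`.
  rest-crossing : ∀ e → crosses rest (ends G e) ≡ true →
    ∃ λ u → ∃ λ v → Joins G e v u × v ∈ rest × ∃ λ i → i < m × u ∈ A i
  rest-crossing e h with crosses-joins G e rest h
  ... | u , v , joins , u∉ , v∈ with anyUpTo? (λ i → u ∈? A i) m
  ...   | yes found = u , v , joins-sym {G = G} {e} joins , v∈ , found
  ...   | no none with u ≟ s
  ...     | no  u≢s  = ⊥-elim (u∉ (∈-fromDec⁺ rest? (u≢s , none)))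
  ...     | yes refl with ∈-fromDec⁻ rest? v∈
  ...       | v≢s , v∉A with edge∈someI {e} (joins-atS {e} joins)
  ...         | i , i<m , e∈I =
    ⊥-elim (v∉A (i , i<m , subst (_∈ A i) (joins-end {e} v≢s joins) (I⇒end∈A i<m e∈I)))

  rest-noExit : ∀ {i j} → Meeting i j → ∀ {e u v} → Joins G e v u → v ∈ rest → u ∈ A i → u ∉ A j
  rest-noExit mt@(meeting i<m j<m _ _) {e} joins v∈ u∈i u∈j with ∈-fromDec⁻ rest? v∈
  ... | v≢s , v∉A = meeting⇒noExit mt {e} joins u∈i u∈j
    (λ v∈i → v∉A (_ , i<m , v∈i)) (λ v∈j → v∉A (_ , j<m , v∈j)) v≢s

  -- Of the `suc (2 * r)` edges leaving `A i ─ A j`, `r` go to `A i ∩ A j` and at least one, a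
  -- private edge of `I i`, goes to `s`.
  rest-endBlob : ∀ {i j r} → Meeting i j → k ≡ suc (2 * r) → between G rest (A i ─ A j) ≤ r
  rest-endBlob {i} {j} {r} mt@(meeting i<m j<m i≢j _) kr with privateEdge i<m j<m i≢j
  ... | e , e∈i , e∉j = s≤s⁻¹ (+-cancelˡ-≤ r _ _ (begin
    r + (1 + between G rest (A i ─ A j))
      ≤⟨ +-monoʳ-≤ r (+-monoˡ-≤ _ (s-edge-into i<m e∈i (private∈A─A i<m j<m e∈i e∉j))) ⟩
    r + (between G (A i ─ A j) ⁅ s ⁆ + between G rest (A i ─ A j))
      ≡⟨ cong (_+ (between G (A i ─ A j) ⁅ s ⁆ + between G rest (A i ─ A j)))
           (half-unique (between G (A i ∩ A j) (A i ─ A j)) r (TightPair.half pair) kr) ⟨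
    between G (A i ∩ A j) (A i ─ A j) + (between G (A i ─ A j) ⁅ s ⁆ + between G rest (A i ─ A j))
      ≤⟨ endBlob-bound G s (A i) (A j) rest (s∉A i<m) s∉rest
           (λ v∈ v∈i → proj₂ (∈-fromDec⁻ rest? v∈) (i , i<m , v∈i)) ⟩
    δsize G (A i ─ A j)
      ≡⟨ trans (TightPair.δA─B pair) kr ⟩
    suc (2 * r)
      ≡⟨ cong (λ x → suc (r + x)) (+-identityʳ r) ⟩
    suc (r + r)
      ≡⟨ +-suc r r ⟨
    r + suc r ∎))
    where
    open ≤-Reasoning

    pair : TightPair G s k (A i) (A j)
    pair = meeting⇒tight mt

  meeting⇒half : ∀ {i j} → 2 ≤ k → Meeting i j → ∃ λ r → k ≡ suc (2 * r) × 1 ≤ r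
  meeting⇒half {i} {j} 2≤k mt = r , half , positive r half
    where
    r : ℕ
    r = between G (A i ∩ A j) (A i ─ A j)

    half : k ≡ suc (2 * r)
    half = TightPair.half (meeting⇒tight mt)

    positive : ∀ r → k ≡ suc (2 * r) → 1 ≤ r
    positive zero    eq = contradiction (subst (2 ≤_) eq 2≤k) λ { (s≤s ()) }
    positive (suc r) _  = s≤s z≤n

  -- The cycle structure

  module _ (order : CycleOrder m I) where

    cycle-meeting : ∀ {i} → i < m → Meeting i (nextC m i)
    cycle-meeting {i} i<m = meeting i<m (nextC-< i<m) i≢
      (proj₂ (proj₂ order i (nextC m i) i<m (nextC-< i<m) i≢) (inj₁ refl))
      where
      i≢ : i ≢ nextC m i
      i≢ = nextC-≢ (≤-trans (n≤1+n 2) (proj₁ order)) i<m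

    cycle-≢3 : m ≢ 3
    cycle-≢3 refl = triangle-impossible (cycle-meeting (s≤s z≤n)) (swap (cycle-meeting {2} ≤-refl))
      (cycle-meeting {1} (s≤s (s≤s z≤n))) λ at → which (edge∈someI at)
      where
      which : ∀ {e} → (∃ λ i → i < 3 × e ∈ I i) → e ∈ I 0 ⊎ e ∈ I 1 ⊎ e ∈ I 2
      which (0 , _ , e∈) = inj₁ e∈
      which (1 , _ , e∈) = inj₂ (inj₁ e∈)
      which (2 , _ , e∈) = inj₂ (inj₂ e∈)
      which (suc (suc (suc _)) , s≤s (s≤s (s≤s ())) , _)

    4≤m : 4 ≤ m
    4≤m = ≤∧≢⇒< (proj₁ order) (cycle-≢3 ∘ sym)

    cycle-nonadjacent : ∀ {i j} → i < m → j < m → i ≢ j → j ≢ nextC m i → i ≢ nextC m j →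
      ∀ {v} → v ∈ A i → v ∉ A j
    cycle-nonadjacent {i} {j} i<m j<m i≢j j≢ i≢ = disjoint i<m j<m i≢j λ mt →
      [ j≢ , i≢ ]′ (proj₁ (proj₂ order i j i<m j<m i≢j) mt)

    cycle-disjoint : ∀ {i} → i < m → ∀ {v} → v ∈ A i → v ∉ A (nextC m (nextC m i))
    cycle-disjoint i<m = cycle-nonadjacent i<m (nextC-< (nextC-< i<m)) (nextC²-≢ (proj₁ order) i<m)
      (nextC-≢ (≤-trans (n≤1+n 2) (proj₁ order)) (nextC-< i<m) ∘ sym) (nextC³-≢ 4≤m i<m)

    H : ℕ → Subset n
    H = cycleBlobs m A

    -- For consecutive blobs the first and last of the sets involved are two steps apart; for all
    -- others `A i` and `A j` are already disjoint.
    H-disjoint : ∀ {i j} → i < m → j < m → i ≢ j → ∀ {v} → v ∈ H i → v ∉ H j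
    H-disjoint {i} {j} i<m j<m i≢j v∈i v∈j
      with x∈p∩q⁻ (A i) (A (nextC m i)) v∈i | x∈p∩q⁻ (A j) (A (nextC m j)) v∈j
         | j ℕ.≟ nextC m i | i ℕ.≟ nextC m j
    ... | a , b | c , d | yes refl | _        = cycle-disjoint i<m a d
    ... | a , b | c , d | no _     | yes refl = cycle-disjoint j<m c b
    ... | a , b | c , d | no j≢    | no i≢    = cycle-nonadjacent i<m j<m i≢j j≢ i≢ a c

    A-next : ∀ {i v} → i < m → v ∈ A (nextC m i) → v ∉ A i → v ∈ A (nextC m (nextC m i))
    A-next i<m = neighbours-cover (swap (cycle-meeting i<m)) (cycle-meeting (nextC-< i<m)) (cycle-disjoint i<m)

    A⊆H : ∀ {i v} → i < m → v ∈ A i → ∃ λ j → j < m × v ∈ H j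
    A⊆H {i} {v} i<m v∈ with v ∈? A (prevC m i)
    ... | yes v∈p = prevC m i , prevC-< i<m ,
      x∈p∩q⁺ (v∈p , subst (λ x → v ∈ A x) (sym (nextC-prevC i<m)) v∈)
    ... | no  v∉p = i , i<m , x∈p∩q⁺ (v∈ , subst (λ x → v ∈ A (nextC m x)) (nextC-prevC i<m)
      (A-next (prevC-< i<m) (subst (λ x → v ∈ A x) (sym (nextC-prevC i<m)) v∈) v∉p))

    -- A nonempty `rest` has an edge in its cut. The outer end lies in some blob, the intersection
    -- of two meeting sets, against `rest-noExit`.
    cycle-rest-empty : ∀ {v} → 2 ≤ k → v ∉ rest
    cycle-rest-empty {v} 2≤k v∈
      with count⇒hit (crosses rest) G (≤-trans (≤-trans (s≤s z≤n) 2≤k)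
             (rest-cut (≤-trans (s≤s z≤n) 4≤m) (v , v∈)))
    ... | e , hit with rest-crossing e hit
    ...   | u , w , joins , w∈ , i , i<m , u∈ with A⊆H i<m u∈
    ...     | j , j<m , u∈H with x∈p∩q⁻ (A j) (A (nextC m j)) u∈H
    ...       | u∈j , u∈nj = rest-noExit (cycle-meeting j<m) {e} joins w∈ u∈j u∈nj

    cycle-cover : 2 ≤ k → ∀ v → v ≢ s → ∃ λ i → i < m × v ∈ H i
    cycle-cover 2≤k v v≢s with anyUpTo? (λ i → v ∈? H i) m
    ... | yes found = found
    ... | no  none  = ⊥-elim (cycle-rest-empty 2≤k (∈-fromDec⁺ rest?
      (v≢s , λ { (i , i<m , v∈) → none (A⊆H i<m v∈) })))

    cycle-blob : ∀ {r} → k ≡ suc (2 * r) → ∀ i → i < m →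
      BlobCondition G s r (H i) (H (prevC m i)) (H (nextC m i))
    cycle-blob {r} kr i i<m = subst₂ (BlobCondition G s r (H i)) (sym previous) (sym next)
      (meeting⇒blob (cycle-meeting i<m) kr)
      where
      -- Rewrites a blob as a difference, so that the blobs on either side of `H i` become the two
      -- differences of one meeting pair.
      around : ∀ {j} → j < m → A j ∩ A (nextC m j) ≡ A (nextC m j) ─ A (nextC m (nextC m j))
      around j<m = neighbour-blob (swap (cycle-meeting j<m)) (cycle-meeting (nextC-< j<m)) (cycle-disjoint j<m)

      previous : H (prevC m i) ≡ A i ─ A (nextC m i)
      previous = trans (around (prevC-< i<m)) (cong (λ x → A x ─ A (nextC m x)) (nextC-prevC i<m))

      next : H (nextC m i) ≡ A (nextC m i) ─ A i
      next = trans (∩-comm (A (nextC m i)) _)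
        (neighbour-blob (cycle-meeting (nextC-< i<m)) (swap (cycle-meeting i<m))
          (λ v∈ v∈′ → cycle-disjoint i<m v∈′ v∈))

    cycleStructure : ∀ {r} → 2 ≤ k → k ≡ suc (2 * r) → 1 ≤ r → CycleStructure G s r m H
    cycleStructure {r} 2≤k kr 1≤r = 1≤r ,
      (proj₁ order ,
       (λ i i<m → meeting⇒nonempty (cycle-meeting i<m) , s∉A i<m ∘ p∩q⊆p (A i) (A (nextC m i))) ,
       (λ i j i<m j<m i≢j v → H-disjoint i<m j<m i≢j) ,
       cycle-cover 2≤k) ,
      cycle-blob {r} kr

    cycle-conclusion : 2 ≤ k → ∃ λ r → k ≡ suc (2 * r) × CycleStructure G s r m H
    cycle-conclusion 2≤k =
      let (r , kr , 1≤r) = meeting⇒half 2≤k (cycle-meeting (≤-trans (s≤s z≤n) (proj₁ order)))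
      in r , kr , cycleStructure {r} 2≤k kr 1≤r

  -- The path structure

  module _ (order : PathOrder m I) where

    -- An edge of `s` and its liftable partner never share an independent set.
    2≤m : 2 ≤ m
    2≤m with count⇒hit _ G (≤-trans (s≤s z≤n) deg≥2)
    ... | e , hit with liftablePartner (hit⇒atS e hit)
    ...   | g , e~g with edge∈someI (proj₁ e~g) | edge∈someI (proj₁ (proj₂ e~g))
    ...     | i , i<m , e∈ | j , j<m , g∈ = distinct⇒2≤ i<m j<m λ { refl → liftable⇒∉I i<m e∈ e~g g∈ }
      where
      distinct⇒2≤ : ∀ {i j} → i < m → j < m → i ≢ j → 2 ≤ m
      distinct⇒2≤ {suc i} i<m j<m i≢j = ≤-trans (s≤s (s≤s z≤n)) i<m
      distinct⇒2≤ {zero} {suc j} i<m j<m i≢j = ≤-trans (s≤s (s≤s z≤n)) j<m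
      distinct⇒2≤ {zero} {zero} i<m j<m i≢j = contradiction refl i≢j

    path-meeting : ∀ {i} → suc i < m → Meeting i (suc i)
    path-meeting {i} lt = meeting i<m lt (λ ()) (proj₂ (order i (suc i) i<m lt λ ()) (inj₁ refl))
      where
      i<m : i < m
      i<m = <-trans ≤-refl lt

    path-nonadjacent : ∀ {i j} → suc i < j → j < m → ∀ {v} → v ∈ A i → v ∉ A j
    path-nonadjacent {i} {j} lt j<m = disjoint i<m j<m (<⇒≢ i<j) λ mt →
      [ (λ j≡ → <⇒≢ lt (sym j≡)) , (λ i≡ → <-asym i<j (≤-reflexive (sym i≡))) ]′
      (proj₁ (order i j i<m j<m (<⇒≢ i<j)) mt)
      where
      i<j : i < j
      i<j = <-trans ≤-refl lt

      i<m : i < m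
      i<m = <-trans i<j j<m

    B : ℕ → Subset n
    B = pathBlobs m A

    -- There are `suc m` blobs for `m` sets: blob `i` lies in the sets with indices `i` and one
    -- less, except that the first blob has no left set and the last no right one.
    B⊆right : ∀ {i v} → i < m → v ∈ B i → v ∈ A i
    B⊆right {zero}  i<m v∈ = p─q⊆p (A 0) (A 1) v∈
    B⊆right {suc j} i<m v∈ rewrite pathBlobs-inner A i<m = p∩q⊆q (A j) (A (suc j)) v∈

    last-index : ∀ {j} → suc j ≡ m → ∃ λ l → j ≡ suc l
    last-index {zero}  eq = contradiction (subst (2 ≤_) (sym eq) 2≤m) λ { (s≤s ()) }
    last-index {suc l} eq = l , refl

    B⊆left : ∀ {j v} → suc j ≤ m → v ∈ B (suc j) → v ∈ A j
    B⊆left {j} j<m v∈ with m≤n⇒m<n∨m≡n j<m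
    ... | inj₁ lt rewrite pathBlobs-inner A lt = p∩q⊆p (A j) (A (suc j)) v∈
    ... | inj₂ eq with last-index eq
    ...   | l , refl rewrite pathBlobs-last A eq = p─q⊆p (A (suc l)) (A l) v∈

    B-skip : ∀ {i v} → suc i < m → v ∈ B i → v ∉ A (suc i)
    B-skip {zero}  lt v∈ = x∈p─q⇒x∉q (A 0) (A 1) v∈
    B-skip {suc i} lt v∈ = path-nonadjacent ≤-refl lt (B⊆left (<⇒≤ (<-trans ≤-refl lt)) v∈)

    B-disjoint< : ∀ {i j} → i < j → j ≤ m → ∀ {v} → v ∈ B i → v ∉ B j
    -- Cases by the gap between the indices. For gap 1 the last blob is separate, being a
    -- difference; gap 2 uses `B-skip`; beyond that the sets containing the blobs are nonadjacent.
    B-disjoint< {i} {suc j} (s≤s i≤j) j<m v∈i v∈j with m≤n⇒m<n∨m≡n i≤j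
    ... | inj₂ refl with m≤n⇒m<n∨m≡n j<m
    ...   | inj₁ lt = B-skip lt v∈i (B⊆right lt v∈j)
    ...   | inj₂ eq with last-index eq
    ...     | l , refl rewrite pathBlobs-last A eq =
      x∈p─q⇒x∉q (A (suc l)) (A l) v∈j (B⊆left (<⇒≤ j<m) v∈i)
    B-disjoint< {i} {suc j} (s≤s i≤j) j<m v∈i v∈j | inj₁ i<j with m≤n⇒m<n∨m≡n i<j
    ...   | inj₂ refl = B-skip j<m v∈i (B⊆left j<m v∈j)
    ...   | inj₁ lt = path-nonadjacent lt j<m (B⊆right (<-trans i<j j<m) v∈i) (B⊆left j<m v∈j)

    B-disjoint : ∀ {i j} → i ≤ m → j ≤ m → i ≢ j → ∀ {v} → v ∈ B i → v ∉ B j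
    B-disjoint {i} {j} i≤m j≤m i≢j v∈i v∈j with <-cmp i j
    ... | tri< i<j _ _ = B-disjoint< i<j j≤m v∈i v∈j
    ... | tri≈ _ i≡j _ = i≢j i≡j
    ... | tri> _ _ j<i = B-disjoint< j<i i≤m v∈j v∈i

    A-next-path : ∀ {i v} → suc (suc i) < m → v ∈ A (suc i) → v ∉ A i → v ∈ A (suc (suc i))
    A-next-path lt = neighbours-cover (swap (path-meeting (<-trans ≤-refl lt))) (path-meeting lt)
      (path-nonadjacent ≤-refl lt)

    A⊆B : ∀ {i v} → i < m → v ∈ A i → ∃ λ j → j < suc m × v ∈ B j
    A⊆B {zero} {v} i<m v∈ with v ∈? A 1
    ... | no  v∉ = 0 , s≤s z≤n , x∈p∧x∉q⇒x∈p─q v∈ v∉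
    ... | yes v∈1 = 1 , s≤s i<m , subst (v ∈_) (sym (pathBlobs-inner A 2≤m)) (x∈p∩q⁺ (v∈ , v∈1))
    A⊆B {suc i} {v} i<m v∈ with v ∈? A i
    ... | yes v∈i = suc i , m≤n⇒m≤1+n i<m , subst (v ∈_) (sym (pathBlobs-inner A i<m)) (x∈p∩q⁺ (v∈i , v∈))
    ... | no  v∉i with m≤n⇒m<n∨m≡n i<m
    ...   | inj₁ lt = suc (suc i) , s≤s i<m ,
      subst (v ∈_) (sym (pathBlobs-inner A lt)) (x∈p∩q⁺ (v∈ , A-next-path lt v∈ v∉i))
    ...   | inj₂ eq = suc (suc i) , s≤s i<m ,
      subst (v ∈_) (sym (pathBlobs-last A eq)) (x∈p∧x∉q⇒x∈p─q v∈ v∉i)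

    -- Edges from `rest` avoid every intersection of consecutive sets, and such intersections cover
    -- the inner sets; only the two end blobs remain.
    rest-exit : ∀ {l} → suc (suc l) ≡ m → ∀ {e u w i} → Joins G e w u → w ∈ rest → i < m → u ∈ A i →
      u ∈ A 0 ─ A 1 ⊎ u ∈ A (suc l) ─ A l
    rest-exit l≡ {e} {u} {i = zero} joins w∈ i<m u∈ =
      inj₁ (x∈p∧x∉q⇒x∈p─q u∈ (rest-noExit (path-meeting 2≤m) {e} joins w∈ u∈))
    rest-exit {l} l≡ {e} {u} {i = suc i} joins w∈ i<m u∈ with m≤n⇒m<n∨m≡n i<m
    ... | inj₁ lt = ⊥-elim (rest-noExit (path-meeting lt) {e} joins w∈ u∈
      (A-next-path lt u∈ (rest-noExit (swap (path-meeting i<m)) {e} joins w∈ u∈)))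
    ... | inj₂ eq with trans eq (sym l≡)
    ...   | refl = inj₂ (x∈p∧x∉q⇒x∈p─q u∈ (rest-noExit (swap (path-meeting i<m)) {e} joins w∈ u∈))

    rest-δ : ∀ {l} → suc (suc l) ≡ m →
      δsize G rest ≤ between G rest (A 0 ─ A 1) + between G rest (A (suc l) ─ A l)
    rest-δ {l} l≡ = subst₂ _≤_ (+-identityʳ _) (cong (between G rest C +_) (+-identityʳ _))
      (totalCount-mono (crosses rest ∷ []) (links rest C ∷ links rest D ∷ []) G bound)
      where
      C D : Subset n
      C = A 0 ─ A 1
      D = A (suc l) ─ A l

      -- Unlike the truth tables, this bound holds only for actual edges of `G`; hence
      -- `totalCount-mono` ranges over positions.
      bound : ∀ e → weight (crosses rest ∷ []) (lookup G e) ≤ weight (links rest C ∷ links rest D ∷ []) (lookup G e)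
      bound e with crosses rest (lookup G e) in hit
      ... | false = z≤n
      ... | true with rest-crossing e hit
      ...   | u , w , joins , w∈ , i , i<m , u∈ with rest-exit l≡ {e} joins w∈ i<m u∈
      ...     | inj₁ u∈C rewrite joins-links {G = G} {e} rest C (joins-sym {G = G} {e} joins) u∈C w∈ = s≤s z≤n
      ...     | inj₂ u∈D rewrite joins-links {G = G} {e} rest D (joins-sym {G = G} {e} joins) u∈D w∈ =
        m≤n+m 1 (indicator (links rest C (lookup G e)))

    -- At most `r` edges reach each end blob, so the cut of `rest` has at most `r + r` edges, one
    -- fewer than `k`.
    path-rest-empty : ∀ {v r} → k ≡ suc (2 * r) → v ∉ rest
    path-rest-empty {v} {r} kr v∈ with m≤n⇒∃[o]m+o≡n 2≤m
    ... | l , l≡ = <⇒≱ (≤-reflexive (trans (cong (λ x → suc (r + x)) (sym (+-identityʳ r))) (sym kr))) (begin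
      k                         ≤⟨ rest-cut (≤-trans (s≤s z≤n) 2≤m) (v , v∈) ⟩
      δsize G rest              ≤⟨ rest-δ l≡ ⟩
      between G rest (A 0 ─ A 1) + between G rest (A (suc l) ─ A l)
                                ≤⟨ +-mono-≤ (rest-endBlob {r = r} (path-meeting 2≤m) kr)
                                     (rest-endBlob {r = r} (swap (path-meeting (≤-reflexive l≡))) kr) ⟩
      r + r                     ∎)
      where open ≤-Reasoning

    path-cover : ∀ {r} → k ≡ suc (2 * r) → ∀ v → v ≢ s → ∃ λ i → i < suc m × v ∈ B i
    path-cover {r} kr v v≢s with anyUpTo? (λ i → v ∈? B i) (suc m)
    ... | yes found = found
    ... | no  none  = ⊥-elim (path-rest-empty {r = r} kr (∈-fromDec⁺ rest?
      (v≢s , λ { (i , i<m , v∈) → none (A⊆B i<m v∈) })))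

    B-nonempty : ∀ {i} → i ≤ m → Nonempty (B i)
    B-nonempty {zero}  _   = difference-nonempty (≤-trans (s≤s z≤n) 2≤m) 2≤m λ ()
    B-nonempty {suc i} i<m with m≤n⇒m<n∨m≡n i<m
    ... | inj₁ lt rewrite pathBlobs-inner A lt = meeting⇒nonempty (path-meeting lt)
    ... | inj₂ eq with last-index eq
    ...   | l , refl rewrite pathBlobs-last A eq = difference-nonempty i<m (<-trans ≤-refl i<m) λ ()

    s∉B : ∀ {i} → i ≤ m → s ∉ B i
    s∉B {zero}  _   = s∉A (≤-trans (s≤s z≤n) 2≤m) ∘ p─q⊆p (A 0) (A 1)
    s∉B {suc i} i<m = s∉A i<m ∘ B⊆left i<m

    -- A neighbouring blob at an end of the path is the required difference by definition; any other
    -- is identified with it by `neighbour-blob`.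
    path-blob : ∀ {r} → k ≡ suc (2 * r) → ∀ {j} → suc j < m →
      BlobCondition G s r (B (suc j)) (B j) (B (suc (suc j)))
    path-blob {r} kr {j} lt rewrite pathBlobs-inner A lt =
      subst₂ (BlobCondition G s r (A j ∩ A (suc j))) (sym (previous lt)) (sym next)
        (meeting⇒blob (path-meeting lt) kr)
      where
      previous : ∀ {j} → suc j < m → B j ≡ A j ─ A (suc j)
      previous {zero}  lt = refl
      previous {suc j} lt = trans (pathBlobs-inner A (<-trans ≤-refl lt))
        (neighbour-blob (swap (path-meeting (<-trans ≤-refl lt))) (path-meeting lt)
          (path-nonadjacent ≤-refl lt))

      next : B (suc (suc j)) ≡ A (suc j) ─ A j
      next with m≤n⇒m<n∨m≡n lt
      ... | inj₂ eq  = pathBlobs-last A eq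
      ... | inj₁ lt′ = trans (pathBlobs-inner A lt′) (trans (∩-comm (A (suc j)) _)
        (neighbour-blob (path-meeting lt′) (swap (path-meeting lt))
          (λ v∈ v∈′ → path-nonadjacent ≤-refl lt′ v∈′ v∈)))

    pathStructure : ∀ {r} → k ≡ suc (2 * r) → 1 ≤ r → PathStructure G s r (suc m) B
    pathStructure {r} kr 1≤r = 1≤r ,
      (s≤s 2≤m ,
       (λ i i<N → B-nonempty (s≤s⁻¹ i<N) , s∉B (s≤s⁻¹ i<N)) ,
       (λ i j i<N j<N i≢j v → B-disjoint (s≤s⁻¹ i<N) (s≤s⁻¹ j<N) i≢j) ,
       path-cover {r} kr) ,
      λ { (suc j) _ lt → path-blob {r} kr (s≤s⁻¹ lt) }

    path-conclusion : 2 ≤ k → ∃ λ r → k ≡ suc (2 * r) × PathStructure G s r (suc m) B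
    path-conclusion 2≤k =
      let (r , kr , 1≤r) = meeting⇒half 2≤k (path-meeting 2≤m)
      in r , kr , pathStructure {r} kr 1≤r

theorem6p1 : ∀ {n} (G : Graph n) (s : Fin n) (k : ℕ) →
    Loopless G → SKEdgeConnected G s k → 2 ≤ k → 4 < deg G s →
    ConnectedOnAtS G s (Liftable G s k) →
    ConnectedOnAtS G s (NonLiftable G s k) →
    (m : ℕ) (I : ℕ → Subset (length G)) (A : ℕ → Subset n) →
    EnumeratesMIS G s k m I →
    (∀ i → i < m → CorrespondingDangerous G s k (I i) (A i)) →
    (CycleOrder m I → ∃ λ r → k ≡ suc (2 * r) × CycleStructure G s r m (cycleBlobs m A)) ×
    (PathOrder m I → ∃ λ r → k ≡ suc (2 * r) × PathStructure G s r (suc m) (pathBlobs m A))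
theorem6p1 G s k loopless conn 2≤k 4<deg L-connected _ m I A enum corr =
  (λ order → cycle-conclusion order 2≤k) , (λ order → path-conclusion order 2≤k)
  where
  liftingData : LiftingData G s k m I A
  liftingData = record
    { loopless    = loopless
    ; conn        = conn
    ; deg≥2       = ≤-trans (s≤s (s≤s z≤n)) 4<deg
    ; L-connected = L-connected
    ; enum        = enum
    ; corr        = corr
    }

  open LiftingGraph liftingData
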